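{- Let $G$ be a simple graph whose line graph $L(G)$ is decomposable into two Hamiltonian cycles (that is, the edge set of $L(G)$ can be partitioned into the edge sets of two Hamiltonian cycles of $L(G)$). Then $G$ is either $K_{1,5}$, or the first subdivision $SG'$ of a $4$-regular graph $G'$ (not necessarily simple) that decomposes into two Hamiltonian cycles, or a Hamiltonian cubic graph.
   Context: The line graph $L(G)$ has the edges of $G$ as vertices, two being adjacent when they share an endpoint in $G$. A graph is decomposable into Hamiltonian cycles if its edge set can be partitioned into edge sets of Hamiltonian cycles. The first subdivision $SG'$ of a graph $G'$ is obtained by subdividing every edge of $G'$ into a path of length $2$.
   Formalization: The graph G is additionally assumed to have no isolated vertices; without this the claim fails, e.g. for K_{1,5} plus an isolated vertex, whose line graph K_5 decomposes into two Hamiltonian cycles. -}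

module Defs where

open import Data.Nat using (ℕ; zero; suc; _≤_)
open import Data.Nat.DivMod using (_mod_)
open import Data.Fin using (Fin; toℕ) renaming (_<_ to _<ᶠ_; zero to fz; suc to fs)
open import Data.Fin.Properties using (_≟_)
open import Data.Bool using (Bool; true; false; T; if_then_else_)
open import Data.List using (List; map; allFin)
open import Data.Nat.ListAction using (sum)
open import Data.Product using (Σ; ∃; _×_; _,_; proj₁; proj₂; Σ-syntax; ∃-syntax)
open import Data.Sum using (_⊎_; inj₁; inj₂)
open import Data.Empty using (⊥)
open import Relation.Nullary using (¬_; does)
open import Relation.Binary.PropositionalEquality using (_≡_; _≢_)
open import Function.Bundles using (_↔_; _⇔_; Inverse)
open import Function.Definitions using (Injective)

record SimpleGraph (n : ℕ) : Set where
  field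
    adj    : Fin n → Fin n → Bool
    sym    : ∀ u v → adj u v ≡ adj v u
    irrefl : ∀ u → adj u u ≡ false

open SimpleGraph public

Adj : ∀ {n} → SimpleGraph n → Fin n → Fin n → Set
Adj G u v = T (adj G u v)

degree : ∀ {n} → SimpleGraph n → Fin n → ℕ
degree {n} G u = sum (map (λ v → if adj G u v then 1 else 0) (allFin n))

next : ∀ {k} → Fin (suc k) → Fin (suc k)
next {k} i = suc (toℕ i) mod (suc k)

record HamCycle {V : Set} (R : V → V → Set) : Set where
  field
    k     : ℕ
    long  : 2 ≤ k
    c     : Fin (suc k) → V
    inj   : Injective _≡_ _≡_ c
    surj  : ∀ v → ∃[ i ] c i ≡ v
    step  : ∀ i → R (c i) (c (next i))

open HamCycle public

CycEdge : ∀ {V : Set} {R : V → V → Set} → HamCycle R → V → V → Set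
CycEdge H x y =
  ∃[ i ] ((c H i ≡ x × c H (next i) ≡ y) ⊎ (c H i ≡ y × c H (next i) ≡ x))

-- R decomposes into two Hamiltonian cycles: every edge of R lies in
-- the edge set of exactly one of the two cycles (cycle edges are edges
-- of R by definition of HamCycle).
DecompTwoHam : ∀ {V : Set} → (V → V → Set) → Set
DecompTwoHam R =
  Σ[ H₁ ∈ HamCycle R ] Σ[ H₂ ∈ HamCycle R ]
    (∀ x y → R x y →
       (CycEdge H₁ x y ⊎ CycEdge H₂ x y) × ¬ (CycEdge H₁ x y × CycEdge H₂ x y))

Edge : ∀ {n} → SimpleGraph n → Set
Edge {n} G = Σ[ u ∈ Fin n ] Σ[ v ∈ Fin n ] (u <ᶠ v × adj G u v ≡ true)

end₁ end₂ : ∀ {n} {G : SimpleGraph n} → Edge G → Fin n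
end₁ e = proj₁ e
end₂ e = proj₁ (proj₂ e)

LAdj : ∀ {n} (G : SimpleGraph n) → Edge G → Edge G → Set
LAdj G e f =
  e ≢ f ×
  (end₁ {G = G} e ≡ end₁ {G = G} f ⊎ end₁ {G = G} e ≡ end₂ {G = G} f ⊎
   end₂ {G = G} e ≡ end₁ {G = G} f ⊎ end₂ {G = G} e ≡ end₂ {G = G} f)

IsoTo : ∀ {n} → SimpleGraph n → (V : Set) → (V → V → Set) → Set
IsoTo {n} G V R =
  Σ[ f ∈ Fin n ↔ V ] (∀ u v → (Adj G u v ⇔ R (Inverse.to f u) (Inverse.to f v)))

StarAdj : Fin 6 → Fin 6 → Set
StarAdj fz fz = ⊥
StarAdj fz (fs _) = Data.Unit.⊤
  where import Data.Unit
StarAdj (fs _) fz = Data.Unit.⊤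
  where import Data.Unit
StarAdj (fs _) (fs _) = ⊥

record MultiGraph : Set where
  field
    p    : ℕ
    q    : ℕ
    ends : Fin q → Fin p × Fin p

open MultiGraph public

Loopless : MultiGraph → Set
Loopless M = ∀ e → proj₁ (ends M e) ≢ proj₂ (ends M e)

-- degree: number of edge-ends at v (a loop would count twice)
mdegree : (M : MultiGraph) → Fin (p M) → ℕ
mdegree M v =
  sum (map (λ e → (if does (proj₁ (ends M e) ≟ v) then 1 else 0)
                 Data.Nat.+ (if does (proj₂ (ends M e) ≟ v) then 1 else 0))
           (allFin (q M)))
  where import Data.Nat

FourRegular : MultiGraph → Set
FourRegular M = ∀ v → mdegree M v ≡ 4

record MHamCycle (M : MultiGraph) : Set where
  field
    k     : ℕ
    c     : Fin (suc k) → Fin (p M)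
    inj   : Injective _≡_ _≡_ c
    surj  : ∀ v → ∃[ i ] c i ≡ v
    d     : Fin (suc k) → Fin (q M)
    dinj  : Injective _≡_ _≡_ d
    joins : ∀ i → ends M (d i) ≡ (c i , c (next i))
                ⊎ ends M (d i) ≡ (c (next i) , c i)

MDecompTwoHam : MultiGraph → Set
MDecompTwoHam M =
  Σ[ H₁ ∈ MHamCycle M ] Σ[ H₂ ∈ MHamCycle M ]
    (∀ e → ((∃[ i ] MHamCycle.d H₁ i ≡ e) ⊎ (∃[ i ] MHamCycle.d H₂ i ≡ e))
         × ¬ ((∃[ i ] MHamCycle.d H₁ i ≡ e) × (∃[ i ] MHamCycle.d H₂ i ≡ e)))

SubAdj : (M : MultiGraph) → Fin (p M) ⊎ Fin (q M) → Fin (p M) ⊎ Fin (q M) → Set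
SubAdj M (inj₁ v) (inj₂ e) = proj₁ (ends M e) ≡ v ⊎ proj₂ (ends M e) ≡ v
SubAdj M (inj₂ e) (inj₁ v) = proj₁ (ends M e) ≡ v ⊎ proj₂ (ends M e) ≡ v
SubAdj M (inj₁ _) (inj₁ _) = ⊥
SubAdj M (inj₂ _) (inj₂ _) = ⊥

{-# OPTIONS --safe #-}

-- L(G) is 4-regular, so the two ends of every edge of G have degree sum 6; as L(G) is connected, the
-- degrees that occur are {1,5}, {2,4} or {3}.  Degrees {1,5} force the star.  Otherwise follow a
-- Hamiltonian cycle e₀ e₁ e₂ … of L(G) and let wᵢ be the vertex shared by eᵢ and eᵢ₊₁.  If the walk w
-- left a vertex v twice, the four edges involved would form a 4-cycle of the other Hamiltonian cycle,
-- and if it missed a vertex v of degree at least 3, three edges at v would form a triangle of the other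
-- one; both are impossible because some edge avoids v.  So w visits each vertex of degree at least 3
-- in one run, and collapsing the runs gives a Hamiltonian cycle of G (degree 3) or of the multigraph
-- on the vertices of degree 4 (degrees 2 and 4).
module Submission where

open import Defs renaming (sym to adj-sym)
open import Data.Bool using (Bool; true; false; T; if_then_else_)
open import Data.Bool.Properties using (T?; T-≡)
open import Data.Empty using (⊥-elim)
open import Data.Fin using (Fin; toℕ; fromℕ<) renaming (zero to fz; suc to fs)
open import Data.Fin.Properties using (_≟_; toℕ-injective; toℕ-fromℕ<; toℕ<n)
import Data.Fin.Properties as Fin
open import Data.List using (List; []; _∷_; _++_; length; map; filter; allFin; lookup)
open import Data.List.Membership.Propositional using (_∈_)
open import Data.List.Membership.Propositional.Properties
  using (∈-∃++; ∈-++⁺ˡ; ∈-++⁺ʳ; ∈-++⁻; ∈-filter⁺; ∈-filter⁻; ∈-allFin; ∈-lookup; ∈-map⁺)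
open import Data.List.Properties using (length-++; length-map; length-tabulate; map-∘; map-cong)
open import Data.List.Relation.Unary.All as All using (All; []; _∷_)
open import Data.List.Relation.Unary.AllPairs using ([]; _∷_)
open import Data.List.Relation.Unary.Any using (here; there; index)
open import Data.List.Relation.Unary.Any.Properties using (lookup-index)
open import Data.List.Relation.Unary.Unique.Propositional using (Unique)
import Data.List.Relation.Unary.Unique.Propositional.Properties as Unique
open import Data.Nat as ℕ using (ℕ; zero; suc; _+_; _*_; _≤_; _<_; z≤n; s≤s; _≤?_)
open import Data.Nat.DivMod
open import Data.Nat.ListAction using (sum)
open import Data.Nat.Properties hiding (_≟_)
open import Data.Product using (Σ; _×_; _,_; proj₁; proj₂; map₂; Σ-syntax; ∃-syntax)
open import Data.Sum as Sum using (_⊎_; inj₁; inj₂; [_,_]′)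
open import Data.Sum.Properties using (inj₁-injective; inj₂-injective)
open import Data.Unit using (⊤; tt)
open import Function using (_∘_; id; _⇔_; mk⇔; Equivalence; mk↔ₛ′; Injective)
open import Relation.Binary.Definitions using (DecidableEquality; tri<; tri≈; tri>)
open import Relation.Binary.PropositionalEquality hiding ([_])
open import Relation.Nullary using (¬_; ¬?; Dec; yes; no; does)
open import Relation.Nullary.Decidable using (map′; _×-dec_)
open import Relation.Unary using (Decidable)

-- Exits of `w` are followed rather than visits because an exit controls the cycle locally: if `w`
-- leaves `v` at position `i`, then `at i` is the only neighbour of `at (suc i)` on that cycle which
-- still contains `v`. Every other pair formed by `at (suc i)` and an edge at `v` is an edge of L(G)
-- outside this cycle, so `cover` hands it to the other one. This is what fills the 4-cycle there.
-- For degrees 2 and 4 one point remains: why the two contracted cycles partition the edges of the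
-- multigraph. A vertex of degree 2 lies on exactly two edges of G, and this pair is a single edge
-- of L(G). It belongs to exactly one of the two Hamiltonian cycles, and the contraction of that
-- cycle is the one that runs through the vertex. L(G) does not see isolated vertices; the theorem
-- excludes them by asking that each vertex have a neighbour.

-- Counting with duplicate-free lists

unique-⊆⇒length-≤ : ∀ {A : Set} {xs ys : List A} → Unique xs → (∀ {x} → x ∈ xs → x ∈ ys) →
  length xs ≤ length ys
unique-⊆⇒length-≤ [] _ = z≤n
unique-⊆⇒length-≤ {xs = x ∷ xs} (x∉xs ∷ xs!) ⊆ with ∈-∃++ (⊆ (here refl))
... | as , bs , refl = begin
  suc (length xs)            ≤⟨ s≤s (unique-⊆⇒length-≤ xs! rest) ⟩
  suc (length (as ++ bs))    ≡⟨ cong suc (length-++ as) ⟩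
  suc (length as + length bs) ≡⟨ +-suc (length as) (length bs) ⟨
  length as + suc (length bs) ≡⟨ length-++ as ⟨
  length (as ++ x ∷ bs)      ∎
  where
  open ≤-Reasoning
  rest : ∀ {y} → y ∈ xs → y ∈ as ++ bs
  rest y∈xs with ∈-++⁻ as (⊆ (there y∈xs))
  ... | inj₁ y∈as = ∈-++⁺ˡ y∈as
  ... | inj₂ (here refl) = ⊥-elim (All.lookup x∉xs y∈xs refl)
  ... | inj₂ (there y∈bs) = ∈-++⁺ʳ as y∈bs

unique-⇔⇒length-≡ : ∀ {A : Set} {xs ys : List A} → Unique xs → Unique ys →
  (∀ {x} → x ∈ xs → x ∈ ys) → (∀ {x} → x ∈ ys → x ∈ xs) → length xs ≡ length ys
unique-⇔⇒length-≡ xs! ys! ⊆ ⊇ = ≤-antisym (unique-⊆⇒length-≤ xs! ⊆) (unique-⊆⇒length-≤ ys! ⊇)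

indicator-T : ∀ {b} → T b → (if b then 1 else 0) ≡ 1
indicator-T {true} _ = refl

indicator-¬T : ∀ {b} → ¬ T b → (if b then 1 else 0) ≡ 0
indicator-¬T {true} ¬t = ⊥-elim (¬t _)
indicator-¬T {false} _ = refl

lookup-injective : ∀ {A : Set} {xs : List A} → Unique xs → Injective _≡_ _≡_ (lookup xs)
lookup-injective (x∉xs ∷ xs!) {fz}   {fz}   _  = refl
lookup-injective (x∉xs ∷ xs!) {fz}   {fs j} eq = ⊥-elim (All.lookup x∉xs (∈-lookup j) eq)
lookup-injective (x∉xs ∷ xs!) {fs i} {fz}   eq = ⊥-elim (All.lookup x∉xs (∈-lookup i) (sym eq))
lookup-injective (x∉xs ∷ xs!) {fs i} {fs j} eq = cong fs (lookup-injective xs! eq)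

enumerate : ∀ {A : Set} {m} {xs : List A} → Unique xs → length xs ≡ m →
  Σ[ f ∈ (Fin m → A) ] (Injective _≡_ _≡_ f × (∀ i → f i ∈ xs) × (∀ {x} → x ∈ xs → ∃[ i ] f i ≡ x))
enumerate {xs = xs} xs! refl =
  lookup xs , lookup-injective xs! , ∈-lookup , λ x∈ → index x∈ , sym (lookup-index x∈)

-- Finite bijections and isomorphisms

isoTo : ∀ {n} {G : SimpleGraph n} {V : Set} {R : V → V → Set} (from : V → Fin n) →
  Injective _≡_ _≡_ from → (∀ u → ∃[ x ] from x ≡ u) →
  (∀ x y → Adj G (from x) (from y) ⇔ R x y) → IsoTo G V R
isoTo {n} {G} {V} {R} from from-inj from-surj adj⇔ =
  mk↔ₛ′ to from (λ x → from-inj (proj₂ (from-surj (from x)))) (proj₂ ∘ from-surj) ,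
  λ u v → subst₂ (λ a b → Adj G a b ⇔ R (to u) (to v)) (proj₂ (from-surj u)) (proj₂ (from-surj v))
    (adj⇔ (to u) (to v))
  where
  to : Fin n → V
  to = proj₁ ∘ from-surj

-- `Fin l ⊎ Fin r` has the shape of the vertex type of a subdivision, so `part` can serve directly
-- as the vertex bijection of an isomorphism.
record Partition {n : ℕ} (P : Fin n → Set) : Set where
  field
    l r            : ℕ
    part           : Fin l ⊎ Fin r → Fin n
    part-injective : Injective _≡_ _≡_ part
    part-surj      : ∀ u → ∃[ x ] part x ≡ u
    left           : ∀ a → P (part (inj₁ a))
    right          : ∀ b → ¬ P (part (inj₂ b))

  left-surj : ∀ {u} → P u → ∃[ a ] part (inj₁ a) ≡ u
  left-surj {u} Pu with part-surj u
  ... | inj₁ a , eq = a , eq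
  ... | inj₂ b , refl = ⊥-elim (right b Pu)

  right-surj : ∀ {u} → ¬ P u → ∃[ b ] part (inj₂ b) ≡ u
  right-surj {u} ¬Pu with part-surj u
  ... | inj₂ b , eq = b , eq
  ... | inj₁ a , refl = ⊥-elim (¬Pu (left a))

partition : ∀ {n} {P : Fin n → Set} → Decidable P → Partition P
partition {zero} P? = record
  { l = 0 ; r = 0 ; part = λ { (inj₁ ()) ; (inj₂ ()) }
  ; part-injective = λ { {inj₁ ()} ; {inj₂ ()} } ; part-surj = λ () ; left = λ () ; right = λ () }
partition {suc n} {P} P? with partition {n} {P ∘ fs} (P? ∘ fs) | P? fz
... | rest | yes P0 = record
  { l = suc l ; r = r ; part = part′ ; part-injective = inj′ ; part-surj = surj′
  ; left = λ { fz → P0 ; (fs a) → left a } ; right = right }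
  where
  open Partition rest
  part′ : Fin (suc l) ⊎ Fin r → Fin (suc n)
  part′ (inj₁ fz) = fz
  part′ (inj₁ (fs a)) = fs (part (inj₁ a))
  part′ (inj₂ b) = fs (part (inj₂ b))
  inj′ : Injective _≡_ _≡_ part′
  inj′ {inj₁ fz} {inj₁ fz} _ = refl
  inj′ {inj₁ (fs a)} {inj₁ (fs b)} eq = cong (inj₁ ∘ fs) (inj₁-injective (part-injective (Fin.suc-injective eq)))
  inj′ {inj₁ (fs a)} {inj₂ b} eq with () ← part-injective (Fin.suc-injective eq)
  inj′ {inj₂ a} {inj₁ (fs b)} eq with () ← part-injective (Fin.suc-injective eq)
  inj′ {inj₂ a} {inj₂ b} eq = cong inj₂ (inj₂-injective (part-injective (Fin.suc-injective eq)))
  surj′ : ∀ u → ∃[ x ] part′ x ≡ u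
  surj′ fz = inj₁ fz , refl
  surj′ (fs u) with part-surj u
  ... | inj₁ a , eq = inj₁ (fs a) , cong fs eq
  ... | inj₂ b , eq = inj₂ b , cong fs eq
... | rest | no ¬P0 = record
  { l = l ; r = suc r ; part = part′ ; part-injective = inj′ ; part-surj = surj′
  ; left = left ; right = λ { fz → ¬P0 ; (fs b) → right b } }
  where
  open Partition rest
  part′ : Fin l ⊎ Fin (suc r) → Fin (suc n)
  part′ (inj₂ fz) = fz
  part′ (inj₂ (fs a)) = fs (part (inj₂ a))
  part′ (inj₁ b) = fs (part (inj₁ b))
  inj′ : Injective _≡_ _≡_ part′
  inj′ {inj₂ fz} {inj₂ fz} _ = refl
  inj′ {inj₂ (fs a)} {inj₂ (fs b)} eq = cong (inj₂ ∘ fs) (inj₂-injective (part-injective (Fin.suc-injective eq)))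
  inj′ {inj₂ (fs a)} {inj₁ b} eq with () ← part-injective (Fin.suc-injective eq)
  inj′ {inj₁ a} {inj₂ (fs b)} eq with () ← part-injective (Fin.suc-injective eq)
  inj′ {inj₁ a} {inj₁ b} eq = cong inj₁ (inj₁-injective (part-injective (Fin.suc-injective eq)))
  surj′ : ∀ u → ∃[ x ] part′ x ≡ u
  surj′ fz = inj₂ fz , refl
  surj′ (fs u) with part-surj u
  ... | inj₂ a , eq = inj₂ (fs a) , cong fs eq
  ... | inj₁ b , eq = inj₁ b , cong fs eq

-- Hamiltonian cycles as periodic sequences

-- Bounded search: the known hit at `i + d` makes the recursion on `d` end.
first-from : ∀ {P : ℕ → Set} → Decidable P → ∀ d i → P (i + d) →
  Σ[ j ∈ ℕ ] (i ≤ j × j ≤ i + d × P j × (∀ l → i ≤ l → l < j → ¬ P l))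
first-from P? zero i p =
  i + 0 , m≤m+n i 0 , ≤-refl , p , λ l i≤l l<i _ → <⇒≱ l<i (≤-trans (≤-reflexive (+-identityʳ i)) i≤l)
first-from {P} P? (suc d) i p with P? i
... | yes q = i , ≤-refl , m≤m+n i _ , q , λ l i≤l l<i _ → <⇒≱ l<i i≤l
... | no ¬q with first-from P? d (suc i) (subst P (+-suc i d) p)
... | j , i<j , j≤ , q , none =
  j , <⇒≤ i<j , ≤-trans j≤ (≤-reflexive (sym (+-suc i d))) , q , before
  where
  before : ∀ l → i ≤ l → l < j → ¬ P l
  before l i≤l l<j with m≤n⇒m<n∨m≡n i≤l
  ... | inj₁ i<l = none l i<l l<j
  ... | inj₂ refl = ¬q

module CyclicSequence {V : Set} {R : V → V → Set} (H : HamCycle R) where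

  N : ℕ
  N = suc (k H)

  opaque
    -- Unrolling the cycle over ℕ makes moving along it a plain successor; the modulus is felt only
    -- in equalities between values of `at`.
    at : ℕ → V
    at i = c H (i mod N)

    %⇒at : ∀ {i j} → i % N ≡ j % N → at i ≡ at j
    %⇒at {i} {j} eq = cong (c H) (toℕ-injective (begin
      toℕ (i mod N) ≡⟨ toℕ-fromℕ< (m%n<n i N) ⟩
      i % N         ≡⟨ eq ⟩
      j % N         ≡⟨ toℕ-fromℕ< (m%n<n j N) ⟨
      toℕ (j mod N) ∎))
      where open ≡-Reasoning

    at⇒% : ∀ {i j} → at i ≡ at j → i % N ≡ j % N
    at⇒% {i} {j} eq = begin
      i % N         ≡⟨ toℕ-fromℕ< (m%n<n i N) ⟨
      toℕ (i mod N) ≡⟨ cong toℕ (inj H eq) ⟩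
      toℕ (j mod N) ≡⟨ toℕ-fromℕ< (m%n<n j N) ⟩
      j % N         ∎
      where open ≡-Reasoning

    at-toℕ : ∀ i → at (toℕ i) ≡ c H i
    at-toℕ i = cong (c H) (toℕ-injective (trans (toℕ-fromℕ< (m%n<n (toℕ i) N)) (m<n⇒m%n≡m (toℕ<n i))))

    at-suc-toℕ : ∀ i → at (suc (toℕ i)) ≡ c H (next i)
    at-suc-toℕ i = refl

    at-next : ∀ i → c H (next (i mod N)) ≡ at (suc i)
    at-next i = %⇒at {suc (toℕ (i mod N))} {suc i} (begin
      suc (toℕ (i mod N)) % N   ≡⟨ cong (λ m → suc m % N) (toℕ-fromℕ< (m%n<n i N)) ⟩
      (1 + i % N) % N           ≡⟨ %-distribˡ-+ 1 (i % N) N ⟩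
      (1 % N + i % N % N) % N   ≡⟨ cong (λ m → (1 % N + m) % N) (m%n%n≡m%n i N) ⟩
      (1 % N + i % N) % N       ≡⟨ %-distribˡ-+ 1 i N ⟨
      suc i % N                 ∎)
      where open ≡-Reasoning

    at-step : ∀ i → R (at i) (at (suc i))
    at-step i = subst (R (at i)) (at-next i) (step H (i mod N))

    at-suc : ∀ {i j} → at i ≡ at j → at (suc i) ≡ at (suc j)
    at-suc {i} {j} eq = trans (sym (at-next i)) (trans (cong (λ x → c H (next x)) (inj H eq)) (at-next j))

    at-period : ∀ i → at (N + i) ≡ at i
    at-period i = %⇒at {N + i} {i} (trans (cong (_% N) (+-comm N i)) ([m+n]%n≡m%n i N))

  at-surj : ∀ x → ∃[ i ] at i ≡ x
  at-surj x with surj H x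
  ... | i , eq = toℕ i , trans (at-toℕ i) eq

  at-shift : ∀ d {i j} → at i ≡ at j → at (d + i) ≡ at (d + j)
  at-shift zero eq = eq
  at-shift (suc d) {i} {j} eq = at-suc {d + i} {d + j} (at-shift d {i} {j} eq)

  -- Another `k H` steps complete a full turn of length `N`, which undoes the single step.
  at-suc-injective : ∀ {i j} → at (suc i) ≡ at (suc j) → at i ≡ at j
  at-suc-injective {i} {j} eq = begin
    at i               ≡⟨ at-period i ⟨
    at (N + i)         ≡⟨ cong at (+-suc (k H) i) ⟨
    at (k H + suc i)   ≡⟨ at-shift (k H) {suc i} {suc j} eq ⟩
    at (k H + suc j)   ≡⟨ cong at (+-suc (k H) j) ⟩
    at (N + j)         ≡⟨ at-period j ⟩
    at j               ∎
    where open ≡-Reasoning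

  at-cancel : ∀ s {i j} → at (s + i) ≡ at (s + j) → at i ≡ at j
  at-cancel zero eq = eq
  at-cancel (suc s) {i} {j} eq = at-cancel s {i} {j} (at-suc-injective {s + i} {s + j} eq)

  at-window-injective : ∀ s {i j} → i < N → j < N → at (s + i) ≡ at (s + j) → i ≡ j
  at-window-injective s {i} {j} i<N j<N eq =
    trans (sym (m<n⇒m%n≡m i<N)) (trans (at⇒% {i} {j} (at-cancel s {i} {j} eq)) (m<n⇒m%n≡m j<N))

  -- The offset from `s` to `j` is `j - s` modulo `N`. Since `N` is `suc (k H)`, the number
  -- `j + s * k H` represents it without subtraction.
  at-window-surj : ∀ s x → ∃[ d ] (d < N × at (s + d) ≡ x)
  at-window-surj s x with at-surj x
  ... | j , refl = m % N , m%n<n m N , (begin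
    at (s + m % N)          ≡⟨ at-shift s {m % N} {m} (%⇒at {m % N} {m} (m%n%n≡m%n m N)) ⟩
    at (s + (j + s * k H))  ≡⟨ cong at rearrange ⟩
    at (j + s * N)          ≡⟨ %⇒at {j + s * N} {j} ([m+kn]%n≡m%n j s N) ⟩
    at j                    ∎)
    where
    open ≡-Reasoning
    m : ℕ
    m = j + s * k H
    rearrange : s + (j + s * k H) ≡ j + s * N
    rearrange = begin
      s + (j + s * k H)  ≡⟨ +-assoc s j (s * k H) ⟨
      s + j + s * k H    ≡⟨ cong (_+ s * k H) (+-comm s j) ⟩
      j + s + s * k H    ≡⟨ +-assoc j s (s * k H) ⟩
      j + (s + s * k H)  ≡⟨ cong (j +_) (*-suc s (k H)) ⟨
      j + s * N          ∎

  at-pred : ∀ x → ∃[ i ] at (suc i) ≡ x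
  at-pred x with at-surj x
  ... | j , eq = k H + j , trans (at-period j) eq

  at≢at+1 : ∀ i → at i ≢ at (suc i)
  at≢at+1 i eq with at-window-injective i {0} {1} (s≤s z≤n) (s≤s (≤-trans (n≤1+n 1) (long H)))
    (subst₂ (λ a b → at a ≡ at b) (+-comm 0 i) (+-comm 1 i) eq)
  ... | ()

  -- `long` gives at least three positions per turn, so 0 and 2 are distinct offsets. Hence the two
  -- neighbours of a point on the cycle are distinct.
  at≢at+2 : ∀ i → at i ≢ at (suc (suc i))
  at≢at+2 i eq with at-window-injective i {0} {2} (s≤s z≤n) (s≤s (long H))
    (subst₂ (λ a b → at a ≡ at b) (+-comm 0 i) (+-comm 2 i) eq)
  ... | ()

  opaque
    unfolding at

    at-edge : ∀ {i x y} → at i ≡ x → at (suc i) ≡ y → CycEdge H x y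
    at-edge {i} ex ey = i mod N , inj₁ (ex , trans (at-next i) ey)

  edge-at : ∀ {x y} → CycEdge H x y →
    ∃[ i ] ((at i ≡ x × at (suc i) ≡ y) ⊎ (at i ≡ y × at (suc i) ≡ x))
  edge-at {x} {y} (i , e) = toℕ i , Sum.map located located e
    where
    located : ∀ {x y} → c H i ≡ x × c H (next i) ≡ y → at (toℕ i) ≡ x × at (suc (toℕ i)) ≡ y
    located (p , q) = trans (at-toℕ i) p , trans (at-suc-toℕ i) q

  edge-sym : ∀ {x y} → CycEdge H x y → CycEdge H y x
  edge-sym (i , e) = i , Sum.swap e

  edge-neighbours : ∀ {i y} → CycEdge H (at (suc i)) y → y ≡ at i ⊎ y ≡ at (suc (suc i))
  edge-neighbours {i} e with edge-at e
  ... | j , inj₁ (p , q) = inj₂ (trans (sym q) (at-suc p))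
  ... | j , inj₂ (p , q) = inj₁ (trans (sym p) (at-suc-injective q))

  two-neighbours : ∀ {x a b y} → CycEdge H x a → CycEdge H x b → a ≢ b → CycEdge H x y →
    y ≡ a ⊎ y ≡ b
  two-neighbours {x} xa xb a≢b xy with at-pred x
  ... | i , refl with edge-neighbours xa | edge-neighbours xb | edge-neighbours xy
  ... | inj₁ refl | inj₁ refl | _         = ⊥-elim (a≢b refl)
  ... | inj₂ refl | inj₂ refl | _         = ⊥-elim (a≢b refl)
  ... | inj₁ refl | inj₂ refl | y∈        = y∈
  ... | inj₂ refl | inj₁ refl | inj₁ y≡   = inj₂ y≡
  ... | inj₂ refl | inj₁ refl | inj₂ y≡   = inj₁ y≡

  neighbours : ∀ x → ∃[ a ] ∃[ b ] (a ≢ b × CycEdge H x a × CycEdge H x b)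
  neighbours x with at-pred x
  ... | i , refl = at i , at (suc (suc i)) , at≢at+2 i ,
    edge-sym (at-edge refl refl) , at-edge refl refl

  edge-relates : (∀ {x y} → R x y → R y x) → ∀ {x y} → CycEdge H x y → R x y
  edge-relates R-sym (i , inj₁ (refl , refl)) = step H i
  edge-relates R-sym (i , inj₂ (refl , refl)) = R-sym (step H i)

  -- Connectedness of the cycle as an induction principle. For a Hamiltonian cycle of L(G) this is
  -- how connectedness of L(G) is used.
  at-induction : (P : V → Set) → ∀ {x} → P x → (∀ {x y} → CycEdge H x y → P x → P y) → ∀ y → P y
  at-induction P {x} px ind y with at-surj x
  ... | s , refl with at-window-surj s y
  ... | d , _ , refl = along d
    where
    along : ∀ d → P (at (s + d))
    along zero = subst P (cong at (sym (+-identityʳ s))) px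
    along (suc d) = subst P (cong at (sym (+-suc s d))) (ind (at-edge refl refl) (along d))

  -- Each corner already has its two cycle neighbours inside the triangle, so the triangle is closed
  -- under cycle edges and connectedness makes it everything.
  triangle-spans : ∀ {x y z} → CycEdge H x y → CycEdge H y z → CycEdge H z x →
    x ≢ y → y ≢ z → z ≢ x → ∀ v → v ∈ x ∷ y ∷ z ∷ []
  triangle-spans {x} {y} {z} xy yz zx x≢y y≢z z≢x = at-induction (_∈ x ∷ y ∷ z ∷ []) (here refl) closed
    where
    closed : ∀ {u v} → CycEdge H u v → u ∈ x ∷ y ∷ z ∷ [] → v ∈ x ∷ y ∷ z ∷ []
    closed uv (here refl) with two-neighbours xy (edge-sym zx) y≢z uv
    ... | inj₁ refl = there (here refl)
    ... | inj₂ refl = there (there (here refl))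
    closed uv (there (here refl)) with two-neighbours yz (edge-sym xy) z≢x uv
    ... | inj₁ refl = there (there (here refl))
    ... | inj₂ refl = here refl
    closed uv (there (there (here refl))) with two-neighbours zx (edge-sym yz) x≢y uv
    ... | inj₁ refl = here refl
    ... | inj₂ refl = there (here refl)

  -- As for the triangle. The neighbours of a corner are the ends of the diagonal avoiding it, and
  -- the two inequalities keep those ends apart.
  quadrangle-spans : ∀ {x y z t} → CycEdge H x y → CycEdge H y z → CycEdge H z t → CycEdge H t x →
    x ≢ z → y ≢ t → ∀ v → v ∈ x ∷ y ∷ z ∷ t ∷ []
  quadrangle-spans {x} {y} {z} {t} xy yz zt tx x≢z y≢t =
    at-induction (_∈ x ∷ y ∷ z ∷ t ∷ []) (here refl) closed
    where
    closed : ∀ {u v} → CycEdge H u v → u ∈ x ∷ y ∷ z ∷ t ∷ [] → v ∈ x ∷ y ∷ z ∷ t ∷ []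
    closed uv (here refl) with two-neighbours xy (edge-sym tx) y≢t uv
    ... | inj₁ refl = there (here refl)
    ... | inj₂ refl = there (there (there (here refl)))
    closed uv (there (here refl)) with two-neighbours (edge-sym xy) yz x≢z uv
    ... | inj₁ refl = here refl
    ... | inj₂ refl = there (there (here refl))
    closed uv (there (there (here refl))) with two-neighbours (edge-sym yz) zt y≢t uv
    ... | inj₁ refl = there (here refl)
    ... | inj₂ refl = there (there (there (here refl)))
    closed uv (there (there (there (here refl)))) with two-neighbours (edge-sym zt) tx (x≢z ∘ sym) uv
    ... | inj₁ refl = there (there (here refl))
    ... | inj₂ refl = here refl

  -- P is meant to depend only on the position modulo N; pos lists one representative of each class.
  record Enumeration (P : ℕ → Set) : Set where
    field
      ℓ             : ℕ
      pos           : Fin (suc ℓ) → ℕ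
      pos-marked    : ∀ t → P (pos t)
      pos-injective : ∀ {t u} → at (pos t) ≡ at (pos u) → t ≡ u
      pos-covers    : ∀ j → P j → ∃[ t ] at (pos t) ≡ at j
      pos-next      : ∀ t → ∃[ j ] (pos t < j × P j × (∀ l → pos t < l → l < j → ¬ P l) ×
                                    at (pos (next t)) ≡ at j)

  -- Starting from a marked position s, the next marked position is iterated; since at has period N the
  -- iteration hits s + N, after which it repeats modulo N.
  module Enumerate (P : ℕ → Set) (P? : Decidable P)
    (P-resp : ∀ {i j} → at i ≡ at j → P i → P j) (s : ℕ) (Ps : P s) where

    opaque
      following : ∀ i → P i → Σ[ j ∈ ℕ ] (i < j × P j × (∀ l → i < l → l < j → ¬ P l))
      -- `suc i + k H` is one full turn after `i`, so `P` holds there again and bounds the search.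
      following i Pi with first-from P? (k H) (suc i)
        (P-resp (sym (trans (cong (λ m → at (suc m)) (+-comm i (k H))) (at-period i))) Pi)
      ... | j , i<j , _ , Pj , none = j , i<j , Pj , none

    marked : ℕ → Σ ℕ P
    marked zero = s , Ps
    marked (suc t) = let i , Pi = marked t ; j , _ , Pj , _ = following i Pi in j , Pj

    m : ℕ → ℕ
    m t = proj₁ (marked t)

    m-< : ∀ t → m t < m (suc t)
    m-< t = proj₁ (proj₂ (following (m t) (proj₂ (marked t))))

    m-none : ∀ t l → m t < l → l < m (suc t) → ¬ P l
    m-none t = proj₂ (proj₂ (proj₂ (following (m t) (proj₂ (marked t)))))

    m-mono-≤ : ∀ {t u} → t ≤ u → m t ≤ m u
    m-mono-≤ {t} {zero} z≤n = ≤-refl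
    m-mono-≤ {t} {suc u} t≤ with m≤n⇒m<n∨m≡n t≤
    ... | inj₁ (s≤s t≤u) = ≤-trans (m-mono-≤ t≤u) (<⇒≤ (m-< u))
    ... | inj₂ refl = ≤-refl

    m-injective : ∀ {t u} → m t ≡ m u → t ≡ u
    m-injective {t} {u} eq with <-cmp t u
    ... | tri≈ _ t≡u _ = t≡u
    ... | tri< t<u _ _ = ⊥-elim (<⇒≢ (≤-trans (m-< t) (m-mono-≤ t<u)) eq)
    ... | tri> _ _ u<t = ⊥-elim (<⇒≢ (≤-trans (m-< u) (m-mono-≤ u<t)) (sym eq))

    m-≥ : ∀ t → s + t ≤ m t
    m-≥ zero = ≤-reflexive (+-identityʳ s)
    m-≥ (suc t) = ≤-trans (≤-reflexive (+-suc s t)) (≤-trans (s≤s (m-≥ t)) (m-< t))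

    m-covers : ∀ {l} → s ≤ l → P l → ∀ t → l < m t → ∃[ u ] (u < t × m u ≡ l)
    m-covers s≤l Pl zero l<s = ⊥-elim (<⇒≱ l<s s≤l)
    m-covers {l} s≤l Pl (suc t) l< with <-cmp l (m t)
    ... | tri≈ _ l≡ _ = t , ≤-refl , sym l≡
    ... | tri> _ _ l> = ⊥-elim (m-none t l l> l< Pl)
    ... | tri< l<′ _ _ with m-covers s≤l Pl t l<′
    ... | u , u<t , eq = u , m≤n⇒m≤1+n u<t , eq

    opaque
      -- Some iterate reaches `s + N` because `m` increases strictly. The first one to do so cannot
      -- jump beyond, as `s + N` is itself marked.
      round : ∃[ ℓ ] (m (suc ℓ) ≡ s + N × (∀ t → t < suc ℓ → m t < s + N))
      round with first-from (λ t → s + N ≤? m t) N 0 (m-≥ N)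
      ... | zero , _ , _ , s+N≤s , _ = ⊥-elim (<⇒≱ (m<m+n s {N} (s≤s z≤n)) s+N≤s)
      ... | suc ℓ , _ , _ , s+N≤ , none =
        ℓ , ≤-antisym (≮⇒≥ λ s+N< → m-none ℓ (s + N) (below ℓ ≤-refl) s+N< P-s+N) s+N≤ , below
        where
        P-s+N : P (s + N)
        P-s+N = P-resp (sym (trans (cong at (+-comm s N)) (at-period s))) Ps
        below : ∀ t → t < suc ℓ → m t < s + N
        below t t<ℓ = ≰⇒> (none t z≤n t<ℓ)

    ℓ : ℕ
    ℓ = proj₁ round

    pos : Fin (suc ℓ) → ℕ
    pos t = m (toℕ t)

    pos-marked : ∀ t → P (pos t)
    pos-marked t = proj₂ (marked (toℕ t))

    -- All listed positions lie in the window from `s` up to but excluding `s + N`, on which `at` is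
    -- injective.
    pos-injective : ∀ {t u} → at (pos t) ≡ at (pos u) → t ≡ u
    pos-injective {t} {u} eq with m≤n⇒∃[o]m+o≡n {s} (start≤ t) | m≤n⇒∃[o]m+o≡n {s} (start≤ u)
      where
      start≤ : ∀ t → s ≤ pos t
      start≤ t = ≤-trans (m≤m+n s _) (m-≥ (toℕ t))
    ... | a , s+a≡ | b , s+b≡ = toℕ-injective (m-injective (trans (sym s+a≡) (trans (cong (s +_)
      (at-window-injective s {a} {b} (offset t s+a≡) (offset u s+b≡)
        (subst₂ (λ x y → at x ≡ at y) (sym s+a≡) (sym s+b≡) eq))) s+b≡)))
      where
      offset : ∀ {a} t → s + a ≡ pos t → a < N
      offset {a} t eq = +-cancelˡ-< s a N (≤-trans (≤-reflexive (cong suc eq)) (proj₂ (proj₂ round) (toℕ t) (toℕ<n t)))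

    pos-covers : ∀ j → P j → ∃[ t ] at (pos t) ≡ at j
    pos-covers j Pj with at-window-surj s (at j)
    ... | d , d<N , eq with m-covers (m≤m+n s d) (P-resp (sym eq) Pj) (suc ℓ)
        (≤-trans (+-monoʳ-< s d<N) (≤-reflexive (sym (proj₁ (proj₂ round)))))
    ... | u , u<ℓ , mu≡ = fromℕ< u<ℓ , trans (cong at (trans (cong m (toℕ-fromℕ< u<ℓ)) mu≡)) eq

    -- After index `ℓ` the list restarts at `s` while the iteration goes on to `s + N`. The next
    -- position is therefore given unwrapped as `j`, and compared with `pos (next t)` only through
    -- `at`.
    pos-next : ∀ t → ∃[ j ] (pos t < j × P j × (∀ l → pos t < l → l < j → ¬ P l) × at (pos (next t)) ≡ at j)
    pos-next t = m (suc (toℕ t)) , m-< (toℕ t) , proj₂ (marked (suc (toℕ t))) , m-none (toℕ t) , wrap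
      where
      toℕ-next : toℕ (next t) ≡ suc (toℕ t) % suc ℓ
      toℕ-next = toℕ-fromℕ< (m%n<n (suc (toℕ t)) (suc ℓ))
      wrap : at (pos (next t)) ≡ at (m (suc (toℕ t)))
      wrap with m≤n⇒m<n∨m≡n (toℕ<n t)
      ... | inj₁ t<ℓ = cong (λ u → at (m u)) (trans toℕ-next (m<n⇒m%n≡m t<ℓ))
      ... | inj₂ t≡ℓ = begin
        at (pos (next t))    ≡⟨ cong (λ u → at (m u)) (trans toℕ-next (trans (cong (_% suc ℓ) t≡ℓ) (n%n≡0 (suc ℓ)))) ⟩
        at s                 ≡⟨ at-period s ⟨
        at (N + s)           ≡⟨ cong at (+-comm N s) ⟩
        at (s + N)           ≡⟨ cong at (proj₁ (proj₂ round)) ⟨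
        at (m (suc ℓ))       ≡⟨ cong (λ u → at (m u)) t≡ℓ ⟨
        at (m (suc (toℕ t))) ∎
        where open ≡-Reasoning

    enumeration : Enumeration P
    enumeration = record
      { ℓ = ℓ ; pos = pos ; pos-marked = pos-marked ; pos-injective = pos-injective
      ; pos-covers = pos-covers ; pos-next = pos-next }

-- Incidence and walks in the line graph

module Incidence {n : ℕ} (G : SimpleGraph n) where

  -- Incidence treats both ends alike and so hides the order `u <ᶠ v` in which an edge stores them.
  data Inc (e : Edge G) : Fin n → Set where
    src : Inc e (end₁ {G = G} e)
    tgt : Inc e (end₂ {G = G} e)

  Inc? : ∀ e v → Dec (Inc e v)
  Inc? e v with end₁ {G = G} e ≟ v | end₂ {G = G} e ≟ v
  ... | yes refl | _        = yes src
  ... | _        | yes refl = yes tgt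
  ... | no ≢₁    | no ≢₂    = no λ { src → ≢₁ refl ; tgt → ≢₂ refl }

  edge-ext : ∀ {e f : Edge G} → end₁ {G = G} e ≡ end₁ {G = G} f → end₂ {G = G} e ≡ end₂ {G = G} f → e ≡ f
  edge-ext {u , v , p , a} {_ , _ , q , b} refl refl =
    cong₂ (λ p a → u , v , p , a) (Fin.<-irrelevant p q) (Bool-irrelevant a b)
    where
    Bool-irrelevant : ∀ {x y : Bool} (p q : x ≡ y) → p ≡ q
    Bool-irrelevant refl refl = refl

  _≟ᴱ_ : DecidableEquality (Edge G)
  e ≟ᴱ f with end₁ {G = G} e ≟ end₁ {G = G} f | end₂ {G = G} e ≟ end₂ {G = G} f
  ... | yes p | yes q = yes (edge-ext p q)
  ... | no ¬p | _     = no λ { refl → ¬p refl }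
  ... | _     | no ¬q = no λ { refl → ¬q refl }

  adj-symmetric : ∀ {u v} → Adj G u v → Adj G v u
  adj-symmetric {u} {v} = subst T (adj-sym G u v)

  adj-irreflexive : ∀ {u v} → Adj G u v → u ≢ v
  adj-irreflexive {u} a refl = subst T (irrefl G u) a

  join : ∀ u v → Adj G u v → Σ[ e ∈ Edge G ] (Inc e u × Inc e v)
  join u v a with Fin.<-cmp u v
  ... | tri< u<v _ _ = (u , v , u<v , Equivalence.to T-≡ a) , src , tgt
  ... | tri> _ _ v<u = (v , u , v<u , Equivalence.to T-≡ (adj-symmetric a)) , tgt , src
  ... | tri≈ _ u≡v _ = ⊥-elim (adj-irreflexive a u≡v)

  inc-adj : ∀ {e u v} → u ≢ v → Inc e u → Inc e v → Adj G u v
  inc-adj u≢v src src = ⊥-elim (u≢v refl)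
  inc-adj u≢v tgt tgt = ⊥-elim (u≢v refl)
  inc-adj {_ , _ , _ , a} u≢v src tgt = Equivalence.from T-≡ a
  inc-adj {_ , _ , _ , a} u≢v tgt src = adj-symmetric (Equivalence.from T-≡ a)

  other-end : ∀ {e u} → Inc e u → ∃[ v ] (u ≢ v × Inc e v)
  other-end {_ , b , a<b , _} src = b , Fin.<⇒≢ a<b , tgt
  other-end {a , _ , a<b , _} tgt = a , Fin.<⇒≢ a<b ∘ sym , src

  two-ends : ∀ {e u v w} → u ≢ v → Inc e u → Inc e v → Inc e w → w ≡ u ⊎ w ≡ v
  two-ends u≢v src src _   = ⊥-elim (u≢v refl)
  two-ends u≢v tgt tgt _   = ⊥-elim (u≢v refl)
  two-ends u≢v src tgt src = inj₁ refl
  two-ends u≢v src tgt tgt = inj₂ refl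
  two-ends u≢v tgt src src = inj₂ refl
  two-ends u≢v tgt src tgt = inj₁ refl

  Inc⁻ : ∀ {e v} → Inc e v → end₁ {G = G} e ≡ v ⊎ end₂ {G = G} e ≡ v
  Inc⁻ src = inj₁ refl
  Inc⁻ tgt = inj₂ refl

  -- Simplicity of G. The crossed cases are void because an edge stores its smaller end first.
  ends-determine : ∀ {e f u v} → u ≢ v → Inc e u → Inc e v → Inc f u → Inc f v → e ≡ f
  ends-determine {_ , _ , p , _} {_ , _ , q , _} u≢v eu ev fu fv
    with Inc⁻ eu | Inc⁻ ev | Inc⁻ fu | Inc⁻ fv
  ... | inj₁ refl | inj₁ refl | _         | _         = ⊥-elim (u≢v refl)
  ... | inj₂ refl | inj₂ refl | _         | _         = ⊥-elim (u≢v refl)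
  ... | _         | _         | inj₁ refl | inj₁ refl = ⊥-elim (u≢v refl)
  ... | _         | _         | inj₂ refl | inj₂ refl = ⊥-elim (u≢v refl)
  ... | inj₁ refl | inj₂ refl | inj₁ refl | inj₂ refl = edge-ext refl refl
  ... | inj₂ refl | inj₁ refl | inj₂ refl | inj₁ refl = edge-ext refl refl
  ... | inj₁ refl | inj₂ refl | inj₂ refl | inj₁ refl = ⊥-elim (Fin.<-asym p q)
  ... | inj₂ refl | inj₁ refl | inj₁ refl | inj₂ refl = ⊥-elim (Fin.<-asym p q)

  -- Consequently an edge of L(G) singles out one vertex of G, which makes the walk `w` well
  -- defined.
  shared-unique : ∀ {e f u v} → e ≢ f → Inc e u → Inc f u → Inc e v → Inc f v → u ≡ v
  shared-unique {u = u} {v} e≢f eu fu ev fv with u ≟ v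
  ... | yes u≡v = u≡v
  ... | no u≢v = ⊥-elim (e≢f (ends-determine u≢v eu ev fu fv))

  LAdj-shared : ∀ {e f} → LAdj G e f → ∃[ v ] (Inc e v × Inc f v)
  LAdj-shared {f = f} (_ , inj₁ p) = _ , src , subst (Inc f) (sym p) src
  LAdj-shared {f = f} (_ , inj₂ (inj₁ p)) = _ , src , subst (Inc f) (sym p) tgt
  LAdj-shared {f = f} (_ , inj₂ (inj₂ (inj₁ p))) = _ , tgt , subst (Inc f) (sym p) src
  LAdj-shared {f = f} (_ , inj₂ (inj₂ (inj₂ p))) = _ , tgt , subst (Inc f) (sym p) tgt

  shared-LAdj : ∀ {e f v} → e ≢ f → Inc e v → Inc f v → LAdj G e f
  shared-LAdj e≢f src fv with Inc⁻ fv
  ... | inj₁ q = e≢f , inj₁ (sym q)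
  ... | inj₂ q = e≢f , inj₂ (inj₁ (sym q))
  shared-LAdj e≢f tgt fv with Inc⁻ fv
  ... | inj₁ q = e≢f , inj₂ (inj₂ (inj₁ (sym q)))
  ... | inj₂ q = e≢f , inj₂ (inj₂ (inj₂ (sym q)))

  LAdj-sym : ∀ {e f} → LAdj G e f → LAdj G f e
  LAdj-sym e~f with LAdj-shared e~f
  ... | _ , ev , fv = shared-LAdj (proj₁ e~f ∘ sym) fv ev

  -- The candidate neighbours are a parameter: all vertices give the degree in G, while the vertices
  -- of degree 2 later give the degree in the multigraph.
  starOn : Fin n → List (Fin n) → List (Edge G)
  starOn v [] = []
  starOn v (x ∷ xs) with T? (adj G v x)
  ... | yes a = proj₁ (join v x a) ∷ starOn v xs
  ... | no _ = starOn v xs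

  starOn-sound : ∀ v xs {e} → e ∈ starOn v xs → ∃[ x ] (x ∈ xs × v ≢ x × Inc e v × Inc e x)
  starOn-sound v (x ∷ xs) e∈ with T? (adj G v x)
  starOn-sound v (x ∷ xs) (here refl) | yes a with join v x a
  ... | _ , ev , ex = x , here refl , adj-irreflexive a , ev , ex
  starOn-sound v (x ∷ xs) (there e∈) | yes a with starOn-sound v xs e∈
  ... | y , y∈ , rest = y , there y∈ , rest
  starOn-sound v (x ∷ xs) e∈ | no _ with starOn-sound v xs e∈
  ... | y , y∈ , rest = y , there y∈ , rest

  starOn-complete : ∀ v xs {e x} → x ∈ xs → v ≢ x → Inc e v → Inc e x → e ∈ starOn v xs
  starOn-complete v (y ∷ xs) (here refl) v≢x ev ex with T? (adj G v y)
  ... | yes a with join v y a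
  ... | _ , fv , fx = here (ends-determine v≢x ev ex fv fx)
  starOn-complete v (y ∷ xs) {e} (here refl) v≢x ev ex | no ¬a = ⊥-elim (¬a (inc-adj {e} v≢x ev ex))
  starOn-complete v (y ∷ xs) (there x∈) v≢x ev ex with T? (adj G v y)
  ... | yes _ = there (starOn-complete v xs x∈ v≢x ev ex)
  ... | no _ = starOn-complete v xs x∈ v≢x ev ex

  starOn-unique : ∀ v xs → Unique xs → Unique (starOn v xs)
  starOn-unique v [] [] = []
  starOn-unique v (x ∷ xs) (x∉xs ∷ xs!) with T? (adj G v x)
  ... | no _ = starOn-unique v xs xs!
  ... | yes a with join v x a
  ... | e , ev , ex = All.tabulate fresh ∷ starOn-unique v xs xs!
    where
    fresh : ∀ {f} → f ∈ starOn v xs → e ≢ f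
    fresh {f} f∈ refl with starOn-sound v xs f∈
    ... | y , y∈ , v≢y , _ , ey with two-ends v≢y ev ey ex
    ... | inj₁ x≡v = adj-irreflexive a (sym x≡v)
    ... | inj₂ x≡y = All.lookup x∉xs y∈ x≡y

  starOn-length : ∀ v xs → length (starOn v xs) ≡ sum (map (λ x → if adj G v x then 1 else 0) xs)
  starOn-length v [] = refl
  starOn-length v (x ∷ xs) with T? (adj G v x)
  ... | yes a = cong₂ _+_ (sym (indicator-T a)) (starOn-length v xs)
  ... | no ¬a = cong₂ _+_ (sym (indicator-¬T ¬a)) (starOn-length v xs)

  star : Fin n → List (Edge G)
  star v = starOn v (allFin n)

  star-sound : ∀ {v e} → e ∈ star v → Inc e v
  star-sound {v} e∈ with starOn-sound v (allFin n) e∈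
  ... | _ , _ , _ , ev , _ = ev

  star-complete : ∀ {v e} → Inc e v → e ∈ star v
  star-complete {v} {e} ev with other-end ev
  ... | x , v≢x , ex = starOn-complete v (allFin n) (∈-allFin x) v≢x ev ex

  star-unique : ∀ v → Unique (star v)
  star-unique v = starOn-unique v (allFin n) (Unique.allFin⁺ n)

  star-length : ∀ v → length (star v) ≡ degree G v
  star-length v = starOn-length v (allFin n)

  branch : ∀ {v e} → 2 ≤ degree G v → Inc e v → ∃[ f ] (f ≢ e × Inc f v)
  branch {v} {e} 2≤ ev with star v | star-unique v | star-length v | (λ {f} → star-sound {v} {f})
  ... | [] | _ | eq | _ = ⊥-elim (<⇒≱ 2≤ (≤-trans (≤-reflexive (sym eq)) z≤n))
  ... | _ ∷ [] | _ | eq | _ = ⊥-elim (<⇒≱ 2≤ (≤-reflexive (sym eq)))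
  ... | a ∷ b ∷ _ | (a≢b ∷ _) ∷ _ | _ | sound with a ≟ᴱ e
  ... | no a≢e = a , a≢e , sound (here refl)
  ... | yes refl = b , a≢b ∘ sym , sound (there (here refl))

  three-edges : ∀ {v} → 3 ≤ degree G v →
    ∃[ a ] ∃[ b ] ∃[ c ] (Inc a v × Inc b v × Inc c v × a ≢ b × b ≢ c × c ≢ a)
  three-edges {v} 3≤ with star v | star-unique v | star-length v | (λ {f} → star-sound {v} {f})
  ... | [] | _ | eq | _ with () ← subst (3 ≤_) (sym eq) 3≤
  ... | _ ∷ [] | _ | eq | _ with s≤s () ← subst (3 ≤_) (sym eq) 3≤
  ... | _ ∷ _ ∷ [] | _ | eq | _ with s≤s (s≤s ()) ← subst (3 ≤_) (sym eq) 3≤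
  ... | a ∷ b ∷ c ∷ _ | (a≢b ∷ a≢c ∷ _) ∷ (b≢c ∷ _) ∷ _ | _ | sound =
    a , b , c , sound (here refl) , sound (there (here refl)) , sound (there (there (here refl))) ,
    a≢b , b≢c , a≢c ∘ sym

  edges-at-≤-degree : ∀ {v es} → Unique es → (∀ {e} → e ∈ es → Inc e v) → length es ≤ degree G v
  edges-at-≤-degree {v} es! inc =
    ≤-trans (unique-⊆⇒length-≤ es! (star-complete ∘ inc)) (≤-reflexive (star-length v))

  degree-pos : ∀ {e v} → Inc e v → 1 ≤ degree G v
  degree-pos {e} ev = edges-at-≤-degree {es = e ∷ []} ([] ∷ []) λ { (here refl) → ev }

  -- Regularity of the line graph and degree sums

  module DegreeSum (H K : HamCycle (LAdj G))
    (cover : ∀ x y → LAdj G x y → CycEdge H x y ⊎ CycEdge K x y)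
    (disjoint : ∀ {x y} → LAdj G x y → CycEdge H x y → ¬ CycEdge K x y) where

    private
      module H = CyclicSequence H
      module K = CyclicSequence K

    -- Two neighbours come from each cycle. The four are distinct because the cycles share no edge,
    -- and exhaustive by `cover`.
    line-neighbours : ∀ e → Σ[ es ∈ List (Edge G) ] (length es ≡ 4 × Unique (e ∷ es) ×
      (∀ {f} → f ∈ es → LAdj G e f) × (∀ {f} → LAdj G e f → f ∈ es))
    line-neighbours e with H.neighbours e | K.neighbours e
    ... | a , b , a≢b , ea , eb | x , y , x≢y , ex , ey =
      a ∷ b ∷ x ∷ y ∷ [] , refl ,
      (proj₁ (H-adj ea) ∷ proj₁ (H-adj eb) ∷ proj₁ (K-adj ex) ∷ proj₁ (K-adj ey) ∷ []) ∷
      (a≢b ∷ apart ea ex ∷ apart ea ey ∷ []) ∷ (apart eb ex ∷ apart eb ey ∷ []) ∷ (x≢y ∷ []) ∷ [] ∷ [] ,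
      All.lookup {P = LAdj G e} (H-adj ea ∷ H-adj eb ∷ K-adj ex ∷ K-adj ey ∷ []) , found
      where
      H-adj : ∀ {f g} → CycEdge H f g → LAdj G f g
      H-adj = H.edge-relates LAdj-sym
      K-adj : ∀ {f g} → CycEdge K f g → LAdj G f g
      K-adj = K.edge-relates LAdj-sym
      apart : ∀ {f g} → CycEdge H e f → CycEdge K e g → f ≢ g
      apart h k refl = disjoint (H-adj h) h k
      found : ∀ {f} → LAdj G e f → f ∈ a ∷ b ∷ x ∷ y ∷ []
      found e~f with cover _ _ e~f
      ... | inj₁ h = [ here , there ∘ here ]′ (H.two-neighbours ea eb a≢b h)
      ... | inj₂ k = [ there ∘ there ∘ here , there ∘ there ∘ there ∘ here ]′ (K.two-neighbours ex ey x≢y k)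

    opaque
      -- The closed neighbourhood of `e` in L(G) has five members. It is the union of the stars of
      -- `u` and `v`, which overlap in `e` alone, so the sum of the degrees is 5 + 1.
      degree-sum : ∀ {e u v} → u ≢ v → Inc e u → Inc e v → degree G u + degree G v ≡ 6
      degree-sum {e} {u} {v} u≢v eu ev with line-neighbours e
      ... | es , |es|≡4 , e∷es! , adjacent , found = begin
        degree G u + degree G v             ≡⟨ cong₂ _+_ (star-length u) (star-length v) ⟨
        length (star u) + length (star v)   ≡⟨ cong (length (star u) +_) star-v ⟩
        length (star u) + suc (length away) ≡⟨ +-suc (length (star u)) (length away) ⟩
        suc (length (star u) + length away) ≡⟨ cong suc (length-++ (star u)) ⟨
        suc (length (star u ++ away))       ≡⟨ cong suc (unique-⇔⇒length-≡ both! e∷es! ⊆ ⊇) ⟩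
        suc (suc (length es))               ≡⟨ cong (suc ∘ suc) |es|≡4 ⟩
        6                                   ∎
        where
        open ≡-Reasoning
        off-u? : ∀ f → Dec (¬ Inc f u)
        off-u? f = ¬? (Inc? f u)
        away : List (Edge G)
        away = filter off-u? (star v)
        away! : Unique away
        away! = Unique.filter⁺ off-u? (star-unique v)
        away⁻ : ∀ {f} → f ∈ away → Inc f v × ¬ Inc f u
        away⁻ f∈ with ∈-filter⁻ off-u? {xs = star v} f∈
        ... | f∈star , ¬fu = star-sound f∈star , ¬fu
        away⁺ : ∀ {f} → Inc f v → ¬ Inc f u → f ∈ away
        away⁺ fv ¬fu = ∈-filter⁺ off-u? (star-complete fv) ¬fu
        star-v : length (star v) ≡ suc (length away)
        star-v = unique-⇔⇒length-≡ (star-unique v)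
          (All.tabulate (λ { f∈ refl → proj₂ (away⁻ f∈) eu }) ∷ away!) ⊆e∷away e∷away⊆
          where
          ⊆e∷away : ∀ {f} → f ∈ star v → f ∈ e ∷ away
          ⊆e∷away {f} f∈ with Inc? f u
          ... | yes fu = here (ends-determine u≢v fu (star-sound f∈) eu ev)
          ... | no ¬fu = there (away⁺ (star-sound f∈) ¬fu)
          e∷away⊆ : ∀ {f} → f ∈ e ∷ away → f ∈ star v
          e∷away⊆ (here refl) = star-complete ev
          e∷away⊆ (there f∈) = star-complete (proj₁ (away⁻ f∈))
        both! : Unique (star u ++ away)
        both! = Unique.++⁺ (star-unique u) away! λ { (f∈u , f∈away) → proj₂ (away⁻ f∈away) (star-sound f∈u) }
        nearby : ∀ {f w} → Inc e w → Inc f w → f ∈ e ∷ es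
        nearby {f} ew fw with e ≟ᴱ f
        ... | yes refl = here refl
        ... | no e≢f = there (found (shared-LAdj e≢f ew fw))
        ⊆ : ∀ {f} → f ∈ star u ++ away → f ∈ e ∷ es
        ⊆ f∈ with ∈-++⁻ (star u) f∈
        ... | inj₁ f∈u = nearby eu (star-sound f∈u)
        ... | inj₂ f∈away = nearby ev (proj₁ (away⁻ f∈away))
        distribute : ∀ {f w} → Inc e w → Inc f w → f ∈ star u ++ away
        distribute {f} ew fw with Inc? f u
        ... | yes fu = ∈-++⁺ˡ (star-complete fu)
        ... | no ¬fu with two-ends u≢v eu ev ew
        ... | inj₁ refl = ⊥-elim (¬fu fw)
        ... | inj₂ refl = ∈-++⁺ʳ (star u) (away⁺ fw ¬fu)
        ⊇ : ∀ {f} → f ∈ e ∷ es → f ∈ star u ++ away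
        ⊇ (here refl) = distribute eu eu
        ⊇ (there f∈) with LAdj-shared (adjacent f∈)
        ... | _ , ew , fw = distribute ew fw

  -- The vertex walk along a Hamiltonian cycle of the line graph

  module LineCycle (H : HamCycle (LAdj G)) where

    open CyclicSequence H

    opaque
      w-spec : ∀ i → ∃[ v ] (Inc (at i) v × Inc (at (suc i)) v)
      w-spec i = LAdj-shared (at-step i)

    w : ℕ → Fin n
    w i = proj₁ (w-spec i)

    w-inc : ∀ i → Inc (at i) (w i)
    w-inc i = proj₁ (proj₂ (w-spec i))

    w-inc′ : ∀ i → Inc (at (suc i)) (w i)
    w-inc′ i = proj₂ (proj₂ (w-spec i))

    w-unique : ∀ {i v} → Inc (at i) v → Inc (at (suc i)) v → w i ≡ v
    w-unique {i} = shared-unique (at≢at+1 i) (w-inc i) (w-inc′ i)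

    w-resp : ∀ {i j} → at i ≡ at j → w i ≡ w j
    w-resp {i} {j} eq = w-unique (subst (λ e → Inc e (w j)) (sym eq) (w-inc j))
      (subst (λ e → Inc e (w j)) (sym (at-suc eq)) (w-inc′ j))

    edge-w : ∀ {e f v} → e ≢ f → Inc e v → Inc f v → CycEdge H e f →
      ∃[ i ] (w i ≡ v × ((at i ≡ e × at (suc i) ≡ f) ⊎ (at i ≡ f × at (suc i) ≡ e)))
    edge-w e≢f ev fv ef with edge-at ef
    ... | i , inj₁ (refl , refl) = i , w-unique ev fv , inj₁ (refl , refl)
    ... | i , inj₂ (refl , refl) = i , w-unique fv ev , inj₂ (refl , refl)

    -- The walk w leaves w i along the edge at (suc i).
    Exit : ℕ → Set
    Exit i = w i ≢ w (suc i)

    -- Otherwise `w i` would be the vertex shared by the next two edges, and the walk would have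
    -- stayed.
    exit-leaves : ∀ {i} → Exit i → ¬ Inc (at (suc (suc i))) (w i)
    exit-leaves {i} exit inc = exit (sym (w-unique (w-inc′ i) inc))

    -- The edge at each position contains the current vertex of the walk, so `w` must leave `v`
    -- before the cycle reaches `e`.
    exit-exists : ∀ {v e} → ¬ Inc e v → ∀ i → w i ≡ v → ∃[ j ] (w j ≡ v × Exit j)
    exit-exists {v} {e} ¬ev i wi with at-window-surj i e
    ... | d , _ , refl = walk d i wi ¬ev
      where
      walk : ∀ d i → w i ≡ v → ¬ Inc (at (i + d)) v → ∃[ j ] (w j ≡ v × Exit j)
      walk zero i refl ¬inc = ⊥-elim (¬inc (subst (λ l → Inc (at l) v) (sym (+-identityʳ i)) (w-inc i)))
      walk (suc d) i wi ¬inc with w (suc i) ≟ v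
      ... | no w≢ = i , wi , λ eq → w≢ (trans (sym eq) wi)
      ... | yes w≡ = walk d (suc i) w≡ (subst (λ l → ¬ Inc (at l) v) (+-suc i d) ¬inc)

  module Trace (H K : HamCycle (LAdj G)) (cover : ∀ x y → LAdj G x y → CycEdge H x y ⊎ CycEdge K x y)
    (missing : ∀ v → ∃[ e ] ¬ Inc e v) where

    open CyclicSequence H
    open LineCycle H
    private module K = CyclicSequence K

    in-K : ∀ {e f v} → e ≢ f → Inc e v → Inc f v → ¬ CycEdge H e f → CycEdge K e f
    in-K e≢f ev fv ¬H with cover _ _ (shared-LAdj e≢f ev fv)
    ... | inj₁ h = ⊥-elim (¬H h)
    ... | inj₂ h = h

    -- If one of the three pairs is an edge of H, the walk is at `v` when H traverses it. Otherwise
    -- all three lie in K.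
    visited : ∀ {v a b c} → Inc a v → Inc b v → Inc c v → a ≢ b → b ≢ c → c ≢ a → ∃[ i ] w i ≡ v
    visited {v} {a} {b} {c} av bv cv a≢b b≢c c≢a
      with cover _ _ (shared-LAdj a≢b av bv) | cover _ _ (shared-LAdj b≢c bv cv) | cover _ _ (shared-LAdj c≢a cv av)
    ... | inj₁ h | _ | _ = map₂ proj₁ (edge-w a≢b av bv h)
    ... | _ | inj₁ h | _ = map₂ proj₁ (edge-w b≢c bv cv h)
    ... | _ | _ | inj₁ h = map₂ proj₁ (edge-w c≢a cv av h)
    ... | inj₂ ab | inj₂ bc | inj₂ ca with missing v
    ... | e , ¬ev = ⊥-elim (¬ev (at-v e))
      where
      at-v : ∀ e → Inc e v
      at-v e = All.lookup {P = λ e → Inc e v} (av ∷ bv ∷ cv ∷ [])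
        (K.triangle-spans ab bc ca a≢b b≢c c≢a e)

    -- Suppose the exits differ. The H-neighbours of `e` are `a` and an edge off `v`; those of `f`
    -- are `b` and an edge off `v`. An H-edge between `a` and `b` would force `b ≡ e` or `a ≡ f`. So
    -- the quadrangle `e`, `f`, `a`, `b` has all its sides in K.
    exit-unique : ∀ {i j} → w i ≡ w j → Exit i → Exit j → at i ≡ at j
    exit-unique {i} {j} wi≡wj exit-i exit-j with at i ≟ᴱ at j
    ... | yes eq = eq
    ... | no a≢b with missing (w i)
    ... | g , ¬gv = ⊥-elim (¬gv (at-v g))
      where
      v : Fin n
      v = w i
      a b e f : Edge G
      a = at i
      b = at j
      e = at (suc i)
      f = at (suc j)
      av : Inc a v
      av = w-inc i
      ev : Inc e v
      ev = w-inc′ i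
      bv : Inc b v
      bv = subst (Inc b) (sym wi≡wj) (w-inc j)
      fv : Inc f v
      fv = subst (Inc f) (sym wi≡wj) (w-inc′ j)
      leaves-i : ∀ {x} → Inc x v → x ≢ at (suc (suc i))
      leaves-i xv refl = exit-leaves exit-i xv
      leaves-j : ∀ {x} → Inc x v → x ≢ at (suc (suc j))
      leaves-j {x} xv refl = exit-leaves exit-j (subst (Inc x) wi≡wj xv)
      e≢f : e ≢ f
      e≢f eq = a≢b (at-suc-injective eq)
      a≢f : a ≢ f
      a≢f eq = leaves-j ev (at-suc eq)
      b≢e : b ≢ e
      b≢e eq = leaves-i fv (at-suc eq)
      e~f : CycEdge K e f
      e~f = in-K e≢f ev fv λ h → [ a≢f ∘ sym , leaves-i fv ]′ (edge-neighbours h)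
      f~a : CycEdge K f a
      f~a = in-K (a≢f ∘ sym) fv av λ h → [ a≢b , leaves-j av ]′ (edge-neighbours h)
      e~b : CycEdge K e b
      e~b = in-K (b≢e ∘ sym) ev bv λ h → [ a≢b ∘ sym , leaves-i bv ]′ (edge-neighbours h)
      a~b : CycEdge K a b
      a~b = in-K a≢b av bv not-H
        where
        not-H : ¬ CycEdge H a b
        not-H h with edge-at h
        ... | l , inj₁ (p , q) = b≢e (trans (sym q) (at-suc p))
        ... | l , inj₂ (p , q) = a≢f (trans (sym q) (at-suc p))
      at-v : ∀ g → Inc g v
      -- The diagonals of the quadrangle are the steps of H from `a` to `e` and from `b` to `f`, so
      -- their ends differ.
      at-v g = All.lookup {P = λ g → Inc g v} (ev ∷ fv ∷ av ∷ bv ∷ [])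
        (K.quadrangle-spans e~f f~a a~b (K.edge-sym e~b) (at≢at+1 i ∘ sym) (at≢at+1 j ∘ sym) g)

  -- Restricted to vertices satisfying Mark, w is a cyclic sequence visiting each of them exactly once.
  module Tour (H K : HamCycle (LAdj G)) (cover : ∀ x y → LAdj G x y → CycEdge H x y ⊎ CycEdge K x y)
    (missing : ∀ v → ∃[ e ] ¬ Inc e v)
    (Mark : Fin n → Set) (Mark? : Decidable Mark) (mark-3≤ : ∀ {v} → Mark v → 3 ≤ degree G v)
    (v₀ : Fin n) (mark-v₀ : Mark v₀) where

    open CyclicSequence H public
    open LineCycle H public
    open Trace H K cover missing public

    Marked : ℕ → Set
    Marked i = Mark (w i) × Exit i

    Marked? : Decidable Marked
    Marked? i = Mark? (w i) ×-dec ¬? (w i ≟ w (suc i))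

    Marked-resp : ∀ {i j} → at i ≡ at j → Marked i → Marked j
    Marked-resp eq = subst₂ (λ u v → Mark u × u ≢ v) (w-resp eq)
      (w-resp (at-suc eq))

    opaque
      exit-from : ∀ {v} → Mark v → ∃[ i ] (w i ≡ v × Marked i)
      exit-from {v} mark-v with three-edges (mark-3≤ mark-v)
      ... | a , b , c , av , bv , cv , a≢b , b≢c , c≢a with visited av bv cv a≢b b≢c c≢a
      ... | i , wi with exit-exists (proj₂ (missing v)) i wi
      ... | j , refl , exit = j , refl , mark-v , exit

    opaque
      marked-positions : Enumeration Marked
      marked-positions =
        Enumerate.enumeration Marked Marked? Marked-resp _ (proj₂ (proj₂ (exit-from mark-v₀)))

    open Enumeration marked-positions public

    route : Fin (suc ℓ) → Fin n
    route t = w (pos t)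

    route-injective : Injective _≡_ _≡_ route
    route-injective {t} {u} eq =
      pos-injective (exit-unique eq (proj₂ (pos-marked t)) (proj₂ (pos-marked u)))

    route-surj : ∀ {v} → Mark v → ∃[ t ] route t ≡ v
    route-surj mark-v with exit-from mark-v
    ... | i , refl , marked with pos-covers i marked
    ... | t , eq = t , w-resp eq

    -- A vertex satisfying `Mark` can be left only at a marked position.
    stay : ∀ i d → Mark (w i) → (∀ l → i ≤ l → l < i + d → ¬ Marked l) → w (i + d) ≡ w i
    stay i zero _ _ = cong w (+-identityʳ i)
    stay i (suc d) mark none with stay i d mark (λ l i≤l l< → none l i≤l (≤-trans l< (+-monoʳ-≤ i (n≤1+n d))))
    ... | w≡ with w (i + d) ≟ w (suc (i + d))
    ... | yes eq = trans (cong w (+-suc i d)) (trans (sym eq) w≡)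
    ... | no ne = ⊥-elim (none (i + d) (m≤m+n i d) (≤-reflexive (sym (+-suc i d))) (subst Mark (sym w≡) mark , ne))

    -- Stops are recorded where the walk leaves a vertex, but adjacency is seen where it enters.
    -- From the entry, `d` positions after `suc (pos t)`, the walk stays put until the next marked
    -- position. Here `d` is 0 in the cubic case and 1 when a vertex of degree 2 is crossed.
    arrive : ∀ t d → (∀ l → pos t < l → l < suc (pos t) + d → ¬ Marked l) → Mark (w (suc (pos t) + d)) →
      route (next t) ≡ w (suc (pos t) + d)
    arrive t d before mark with pos-next t
    ... | j , pos<j , marked-j , none , eq
      with m≤n⇒∃[o]m+o≡n {suc (pos t) + d} {j} (≮⇒≥ λ j< → before j pos<j j< marked-j)
    ... | e , refl = trans (w-resp eq)
      (stay (suc (pos t) + d) e mark λ l i≤l → none l (≤-trans (m≤m+n (suc (pos t)) d) i≤l))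

-- The three degree patterns

module Decomposition {n : ℕ} (G : SimpleGraph n) (H K : HamCycle (LAdj G))
  (cover : ∀ x y → LAdj G x y → CycEdge H x y ⊎ CycEdge K x y)
  (disjoint : ∀ {x y} → LAdj G x y → CycEdge H x y → ¬ CycEdge K x y)
  (inhabited : ∀ u → ∃[ v ] Adj G u v) where

  open Incidence G
  open DegreeSum H K cover disjoint

  -- A neighbour `u` of `v` has a second edge, and that edge cannot also contain `v` without being
  -- parallel to the first.
  edge-missing : (∀ v → 2 ≤ degree G v) → ∀ v → ∃[ e ] ¬ Inc e v
  edge-missing 2≤ v with inhabited v
  ... | u , v~u with join v u v~u
  ... | e , ev , eu with branch (2≤ u) eu
  ... | f , f≢e , fu = f , λ fv → f≢e (ends-determine (adj-irreflexive v~u) fv fu ev eu)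

  cover-swap : ∀ x y → LAdj G x y → CycEdge K x y ⊎ CycEdge H x y
  cover-swap x y = Sum.swap ∘ cover x y

  -- Every vertex is marked, so the vertex entered right after an exit is already the next stop, and
  -- `at (suc (pos t))` joins the two.
  cubic-hamiltonian : (∀ v → degree G v ≡ 3) → Fin n → HamCycle (Adj G)
  cubic-hamiltonian cubic v₀ = record
    { k = ℓ ; long = long′ ; c = route ; inj = route-injective ; surj = λ v → route-surj {v} tt ; step = adjacent }
    where
    open Tour H K cover (edge-missing λ v → subst (2 ≤_) (sym (cubic v)) (s≤s (s≤s z≤n)))
      (λ _ → ⊤) (λ _ → yes tt) (λ {v} _ → ≤-reflexive (sym (cubic v))) v₀ tt

    adjacent : ∀ t → Adj G (route t) (route (next t))
    adjacent t = subst (Adj G (route t))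
      (sym (trans (arrive t 0 between tt) (cong w (+-identityʳ (suc (pos t))))))
      (inc-adj (proj₂ (pos-marked t)) (w-inc′ (pos t)) (w-inc (suc (pos t))))
      where
      between : ∀ l → pos t < l → l < suc (pos t) + 0 → ¬ Marked l
      between l pos<l l< _ = <⇒≱ l< (subst (_≤ l) (sym (+-identityʳ (suc (pos t)))) pos<l)

    -- The three neighbours of `v₀` are distinct and all lie on the route.
    long′ : 2 ≤ ℓ
    long′ with three-edges {v₀} (≤-reflexive (sym (cubic v₀)))
    ... | a , b , c , av , bv , cv , a≢b , b≢c , c≢a
      with other-end av | other-end bv | other-end cv
    ... | x , v≢x , ax | y , v≢y , by | z , v≢z , cz =
      ≤-pred (subst (3 ≤_) (trans (length-map route (allFin (suc ℓ))) (length-tabulate {n = suc ℓ} id))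
        (unique-⊆⇒length-≤
          ((distinct a≢b v≢x av ax bv by ∷ (distinct c≢a v≢z cv cz av ax ∘ sym) ∷ []) ∷
           (distinct b≢c v≢y bv by cv cz ∷ []) ∷ [] ∷ [])
          λ {u} _ → on-route u))
      where
      distinct : ∀ {e f x y} → e ≢ f → v₀ ≢ x → Inc e v₀ → Inc e x → Inc f v₀ → Inc f y → x ≢ y
      distinct e≢f v≢x ev ex fv fx refl = e≢f (ends-determine v≢x ev ex fv fx)
      on-route : ∀ u → u ∈ map route (allFin (suc ℓ))
      on-route u with route-surj {u} tt
      ... | t , refl = ∈-map⁺ route (∈-allFin t)

  at-most : ∀ {v m es} → degree G v ≡ m → Unique es → All (λ e → Inc e v) es → length es ≤ m
  at-most eq es! inc = ≤-trans (edges-at-≤-degree es! (All.lookup inc)) (≤-reflexive eq)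

  opaque
    leaf-edge : ∀ {e f v} → degree G v ≡ 1 → Inc e v → Inc f v → e ≡ f
    leaf-edge {e} {f} eq ev fv with e ≟ᴱ f
    ... | yes e≡f = e≡f
    ... | no e≢f with s≤s () ← at-most eq ((e≢f ∷ []) ∷ [] ∷ []) (ev ∷ fv ∷ [])

    mid-edge : ∀ {e f g v} → degree G v ≡ 2 → Inc e v → Inc f v → e ≢ f → Inc g v → g ≡ e ⊎ g ≡ f
    mid-edge {e} {f} {g} eq ev fv e≢f gv with g ≟ᴱ e | g ≟ᴱ f
    ... | yes g≡e | _       = inj₁ g≡e
    ... | no _    | yes g≡f = inj₂ g≡f
    ... | no g≢e  | no g≢f
      with s≤s (s≤s ()) ← at-most eq ((g≢e ∷ g≢f ∷ []) ∷ (e≢f ∷ []) ∷ [] ∷ []) (gv ∷ ev ∷ fv ∷ [])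

  -- By `degree-sum` the degree alternates along edges between that of `v` and its complement to 6,
  -- and H links all edges together.
  degree-dichotomy : ∀ {e v} → Inc e v → ∀ u → degree G u ≡ degree G v ⊎ degree G u + degree G v ≡ 6
  degree-dichotomy {e} {v} ev u with inhabited u
  ... | x , u~x with join u x u~x
  ... | f , fu , _ = H.at-induction Good base spread f fu
    where
    module H = CyclicSequence H
    Good : Edge G → Set
    Good f = ∀ {u} → Inc f u → degree G u ≡ degree G v ⊎ degree G u + degree G v ≡ 6
    along : ∀ {f x} → Inc f x → degree G x ≡ degree G v ⊎ degree G x + degree G v ≡ 6 → Good f
    along {f} {x} fx good {y} fy with x ≟ y
    ... | yes refl = good
    ... | no x≢y with good
    ... | inj₁ eq = inj₂ (trans (cong (degree G y +_) (sym eq)) (degree-sum (x≢y ∘ sym) fy fx))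
    ... | inj₂ eq = inj₁ (+-cancelˡ-≡ (degree G x) _ _ (trans (degree-sum x≢y fx fy) (sym eq)))
    base : Good e
    base = along ev (inj₁ refl)
    spread : ∀ {f g} → CycEdge H f g → Good f → Good g
    spread fg good with LAdj-shared (H.edge-relates LAdj-sym fg)
    ... | _ , fx , gx = along gx (good fx)

  -- The far end of an edge at `v` has degree 1, so H can pass to another edge only through `v`.
  -- Hence every edge contains `v`, and every vertex lies on an edge.
  star-iso : ∀ v → degree G v ≡ 5 → IsoTo G (Fin 6) StarAdj
  star-iso v deg-v with enumerate (star-unique v) (trans (star-length v) deg-v)
  ... | edge , edge-injective , edge∈ , edge-surj = isoTo {G = G} vertex vertex-injective vertex-surj adjacency
    where
    through-v : ∀ e → Inc e v
    through-v with inhabited v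
    ... | u , v~u with join v u v~u
    ... | e , ev , _ = CyclicSequence.at-induction H (λ e → Inc e v) ev spread
      where
      spread : ∀ {f g} → CycEdge H f g → Inc f v → Inc g v
      spread {f} {g} fg fv with LAdj-shared (CyclicSequence.edge-relates H LAdj-sym fg)
      ... | x , fx , gx with v ≟ x
      ... | yes refl = gx
      ... | no v≢x = subst (λ g → Inc g v) (leaf-edge leaf fx gx) fv
        where
        leaf : degree G x ≡ 1
        leaf = +-cancelˡ-≡ 5 _ _ (trans (cong (_+ degree G x) (sym deg-v)) (degree-sum v≢x fv fx))

    leaf : ∀ i → ∃[ u ] (v ≢ u × Inc (edge i) u)
    leaf i = other-end (through-v (edge i))

    vertex : Fin 6 → Fin n
    vertex fz = v
    vertex (fs i) = proj₁ (leaf i)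

    v≢leaf : ∀ i → v ≢ vertex (fs i)
    v≢leaf i = proj₁ (proj₂ (leaf i))

    edge-leaf : ∀ i → Inc (edge i) (vertex (fs i))
    edge-leaf i = proj₂ (proj₂ (leaf i))

    vertex-injective : Injective _≡_ _≡_ vertex
    vertex-injective {fz} {fz} _ = refl
    vertex-injective {fz} {fs j} eq = ⊥-elim (v≢leaf j eq)
    vertex-injective {fs i} {fz} eq = ⊥-elim (v≢leaf i (sym eq))
    vertex-injective {fs i} {fs j} eq = cong fs (edge-injective (ends-determine (v≢leaf i)
      (through-v (edge i)) (edge-leaf i) (through-v (edge j)) (subst (Inc (edge j)) (sym eq) (edge-leaf j))))

    vertex-surj : ∀ u → ∃[ i ] vertex i ≡ u
    vertex-surj u with inhabited u
    ... | x , u~x with join u x u~x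
    ... | e , eu , _ with edge-surj (star-complete (through-v e))
    ... | i , refl with two-ends (v≢leaf i) (through-v e) (edge-leaf i) eu
    ... | inj₁ u≡v = fz , sym u≡v
    ... | inj₂ u≡leaf = fs i , sym u≡leaf

    spoke : ∀ i → Adj G v (vertex (fs i))
    spoke i = inc-adj (v≢leaf i) (through-v (edge i)) (edge-leaf i)

    adjacency : ∀ i j → Adj G (vertex i) (vertex j) ⇔ StarAdj i j
    adjacency fz fz = mk⇔ (λ a → adj-irreflexive a refl) ⊥-elim
    adjacency fz (fs j) = mk⇔ (λ _ → tt) (λ _ → spoke j)
    adjacency (fs i) fz = mk⇔ (λ _ → tt) (λ _ → adj-symmetric (spoke i))
    adjacency (fs i) (fs j) = mk⇔ apart ⊥-elim
      where
      apart : ¬ Adj G (vertex (fs i)) (vertex (fs j))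
      apart a with join _ _ a
      ... | e , ei , ej with two-ends (v≢leaf i) (through-v e) ei ej
      ... | inj₁ j≡v = v≢leaf j (sym j≡v)
      ... | inj₂ j≡i = adj-irreflexive a (sym j≡i)

  -- Degrees 2 and 4: the multigraph and its two Hamiltonian cycles

  module Subdivision (two-or-four : ∀ v → degree G v ≡ 2 ⊎ degree G v ≡ 4)
    (v₀ : Fin n) (deg-v₀ : degree G v₀ ≡ 4) where

    record Hub (v : Fin n) : Set where
      constructor is-hub
      field degree≡4 : degree G v ≡ 4

    open Hub

    Hub? : Decidable Hub
    Hub? v = map′ is-hub degree≡4 (degree G v ℕ.≟ 4)

    ¬hub⇒2 : ∀ {v} → ¬ Hub v → degree G v ≡ 2
    ¬hub⇒2 {v} ¬hub = [ id , ⊥-elim ∘ ¬hub ∘ is-hub ]′ (two-or-four v)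

    opaque
      hub⇒¬hub : ∀ {e u v} → u ≢ v → Inc e u → Inc e v → Hub u → ¬ Hub v
      hub⇒¬hub u≢v eu ev hub-u hub-v = 8≢6
        (trans (sym (cong₂ _+_ (degree≡4 hub-u) (degree≡4 hub-v))) (degree-sum u≢v eu ev))
        where
        8≢6 : 8 ≢ 6
        8≢6 ()

      ¬hub⇒hub : ∀ {e u v} → u ≢ v → Inc e u → Inc e v → ¬ Hub u → Hub v
      ¬hub⇒hub {v = v} u≢v eu ev ¬hub = is-hub (
        +-cancelˡ-≡ 2 _ _ (trans (cong (_+ degree G v) (sym (¬hub⇒2 ¬hub))) (degree-sum u≢v eu ev)))

    2≤degree : ∀ v → 2 ≤ degree G v
    2≤degree v with two-or-four v
    ... | inj₁ eq = ≤-reflexive (sym eq)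
    ... | inj₂ eq = subst (2 ≤_) (sym eq) (s≤s (s≤s z≤n))

    opaque
      hubs : Partition Hub
      hubs = partition Hub?

    open Partition hubs

    hub : Fin l → Fin n
    hub a = part (inj₁ a)

    mid : Fin r → Fin n
    mid b = part (inj₂ b)

    hub-injective : Injective _≡_ _≡_ hub
    hub-injective eq = inj₁-injective (part-injective eq)

    mid-injective : Injective _≡_ _≡_ mid
    mid-injective eq = inj₂-injective (part-injective eq)

    hub≢mid : ∀ {a b} → hub a ≢ mid b
    hub≢mid eq with () ← part-injective eq

    opaque
      mid-edges : ∀ b → ∃[ e ] ∃[ f ] (e ≢ f × Inc e (mid b) × Inc f (mid b))
      mid-edges b with inhabited (mid b)
      ... | u , b~u with join (mid b) u b~u
      ... | e , eb , _ with branch (2≤degree (mid b)) eb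
      ... | f , f≢e , fb = e , f , f≢e ∘ sym , eb , fb

      -- The two edges at a vertex of degree 2 lead to vertices of degree 4, distinct because G has
      -- no parallel edges. Which comes first is arbitrary.
      span : ∀ b → ∃[ a₁ ] ∃[ a₂ ] (a₁ ≢ a₂ × Adj G (mid b) (hub a₁) × Adj G (mid b) (hub a₂) ×
        (∀ a → Adj G (mid b) (hub a) → a₁ ≡ a ⊎ a₂ ≡ a))
      span b with mid-edges b
      ... | e , f , e≢f , eb , fb with other-end eb | other-end fb
      ... | x , b≢x , ex | y , b≢y , fy
        with left-surj (¬hub⇒hub b≢x eb ex (right b)) | left-surj (¬hub⇒hub b≢y fb fy (right b))
      ... | a₁ , refl | a₂ , refl = a₁ , a₂ , (λ { refl → e≢f (ends-determine b≢x eb ex fb fy) }) ,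
        inc-adj b≢x eb ex , inc-adj b≢y fb fy , only
        where
        only : ∀ a → Adj G (mid b) (hub a) → a₁ ≡ a ⊎ a₂ ≡ a
        only a b~a with join _ _ b~a
        ... | g , gb , ga with mid-edge (¬hub⇒2 (right b)) eb fb e≢f gb
        ... | inj₁ refl = inj₁ (hub-injective ([ ⊥-elim ∘ b≢x ∘ sym , id ]′ (two-ends (hub≢mid ∘ sym) gb ga ex)))
        ... | inj₂ refl = inj₂ (hub-injective ([ ⊥-elim ∘ b≢y ∘ sym , id ]′ (two-ends (hub≢mid ∘ sym) gb ga fy)))

    -- Suppressing the vertices of degree 2 turns each into an edge; several may join the same two
    -- hubs, hence a multigraph.
    M : MultiGraph
    M = record { p = l ; q = r ; ends = λ b → proj₁ (span b) , proj₁ (proj₂ (span b)) }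

    Meets : Fin r → Fin l → Set
    Meets b a = proj₁ (ends M b) ≡ a ⊎ proj₂ (ends M b) ≡ a

    loopless : Loopless M
    loopless b = proj₁ (proj₂ (proj₂ (span b)))

    adj⇒meets : ∀ {a b} → Adj G (mid b) (hub a) → Meets b a
    adj⇒meets {a} {b} = proj₂ (proj₂ (proj₂ (proj₂ (proj₂ (span b))))) a

    meets⇒adj : ∀ {a b} → Meets b a → Adj G (mid b) (hub a)
    meets⇒adj {b = b} (inj₁ refl) = proj₁ (proj₂ (proj₂ (proj₂ (span b))))
    meets⇒adj {b = b} (inj₂ refl) = proj₁ (proj₂ (proj₂ (proj₂ (proj₂ (span b)))))

    subdivision-iso : IsoTo G (Fin l ⊎ Fin r) (SubAdj M)
    subdivision-iso = isoTo {G = G} part part-injective part-surj adjacency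
      where
      adjacency : ∀ x y → Adj G (part x) (part y) ⇔ SubAdj M x y
      adjacency (inj₁ a) (inj₂ b) = mk⇔ (adj⇒meets ∘ adj-symmetric) (adj-symmetric ∘ meets⇒adj)
      adjacency (inj₂ b) (inj₁ a) = mk⇔ adj⇒meets meets⇒adj
      adjacency (inj₁ a) (inj₁ a′) = mk⇔ apart ⊥-elim
        where
        apart : ¬ Adj G (hub a) (hub a′)
        apart a~a′ with join _ _ a~a′
        ... | e , ea , ea′ = hub⇒¬hub (adj-irreflexive a~a′) ea ea′ (left a) (left a′)
      adjacency (inj₂ b) (inj₂ b′) = mk⇔ apart ⊥-elim
        where
        apart : ¬ Adj G (mid b) (mid b′)
        apart b~b′ with join _ _ b~b′
        ... | e , eb , eb′ = right b′ (¬hub⇒hub (adj-irreflexive b~b′) eb eb′ (right b))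

    -- An edge of `M` contributes exactly one end at `a` when its mid is adjacent to `hub a`, and
    -- none otherwise. All neighbours of a hub are mids, so the sum is the degree in G.
    four-regular : FourRegular M
    four-regular a = begin
      mdegree M a                                            ≡⟨ cong sum (map-cong indicator (allFin r)) ⟩
      sum (map (neighbour ∘ mid) (allFin r))                 ≡⟨ cong sum (map-∘ (allFin r)) ⟩
      sum (map neighbour (map mid (allFin r)))               ≡⟨ starOn-length (hub a) (map mid (allFin r)) ⟨
      length (starOn (hub a) (map mid (allFin r)))           ≡⟨ unique-⇔⇒length-≡
                                                                  (starOn-unique (hub a) (map mid (allFin r)) (Unique.map⁺ mid-injective (Unique.allFin⁺ r)))
                                                                  (star-unique (hub a)) ⊆ ⊇ ⟩
      length (star (hub a))                                  ≡⟨ star-length (hub a) ⟩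
      degree G (hub a)                                       ≡⟨ degree≡4 (left a) ⟩
      4                                                      ∎
      where
      open ≡-Reasoning
      neighbour : Fin n → ℕ
      neighbour x = if adj G (hub a) x then 1 else 0
      indicator : ∀ b → (if does (proj₁ (ends M b) ≟ a) then 1 else 0) +
                        (if does (proj₂ (ends M b) ≟ a) then 1 else 0) ≡ neighbour (mid b)
      indicator b with proj₁ (ends M b) ≟ a | proj₂ (ends M b) ≟ a
      ... | yes a₁≡a | yes a₂≡a = ⊥-elim (loopless b (trans a₁≡a (sym a₂≡a)))
      ... | yes a₁≡a | no _ = sym (indicator-T (adj-symmetric (meets⇒adj (inj₁ a₁≡a))))
      ... | no _ | yes a₂≡a = sym (indicator-T (adj-symmetric (meets⇒adj (inj₂ a₂≡a))))
      ... | no a₁≢a | no a₂≢a = sym (indicator-¬T ([ a₁≢a , a₂≢a ]′ ∘ adj⇒meets ∘ adj-symmetric))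
      ⊆ : ∀ {e} → e ∈ starOn (hub a) (map mid (allFin r)) → e ∈ star (hub a)
      ⊆ e∈ with starOn-sound (hub a) (map mid (allFin r)) e∈
      ... | _ , _ , _ , ea , _ = star-complete ea
      ⊇ : ∀ {e} → e ∈ star (hub a) → e ∈ starOn (hub a) (map mid (allFin r))
      ⊇ e∈ with other-end (star-sound e∈)
      ... | x , a≢x , ex with right-surj (hub⇒¬hub a≢x (star-sound e∈) ex (left a))
      ... | b , refl = starOn-complete (hub a) (map mid (allFin r)) (∈-map⁺ mid (∈-allFin b)) a≢x (star-sound e∈) ex

    module Contract (H K : HamCycle (LAdj G)) (cover : ∀ x y → LAdj G x y → CycEdge H x y ⊎ CycEdge K x y) where

      open Tour H K cover (edge-missing 2≤degree) Hub Hub? (λ hub-v → subst (3 ≤_) (sym (degree≡4 hub-v)) (s≤s (s≤s (s≤s z≤n)))) v₀ (is-hub deg-v₀)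

      opaque
        mid-after : ∀ t → ¬ Hub (w (suc (pos t)))
        mid-after t = hub⇒¬hub (proj₂ (pos-marked t)) (w-inc′ (pos t)) (w-inc (suc (pos t))) (proj₁ (pos-marked t))

        -- Staying would put three distinct consecutive edges of the cycle at a vertex of degree 2.
        mid-exits : ∀ i → ¬ Hub (w i) → Exit i
        mid-exits i ¬hub same with s≤s (s≤s ()) ← at-most (¬hub⇒2 ¬hub)
          ((at≢at+1 i ∷ at≢at+2 i ∷ []) ∷ (at≢at+1 (suc i) ∷ []) ∷ [] ∷ [])
          (w-inc i ∷ w-inc′ i ∷ subst (Inc (at (suc (suc i)))) (sym same) (w-inc′ (suc i)) ∷ [])

        hub-after : ∀ i → ¬ Hub (w i) → Hub (w (suc i))
        hub-after i ¬hub = ¬hub⇒hub (mid-exits i ¬hub) (w-inc′ i) (w-inc (suc i)) ¬hub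

        -- From a hub the walk enters a mid and moves straight on to a hub, two positions later;
        -- `arrive` carries this entry over to the exit.
        route-next : ∀ t → route (next t) ≡ w (suc (suc (pos t)))
        route-next t = trans (arrive t 1 between (subst Hub (sym shift) (hub-after (suc (pos t)) (mid-after t)))) shift
          where
          shift : w (suc (pos t) + 1) ≡ w (suc (suc (pos t)))
          shift = cong w (+-comm (suc (pos t)) 1)
          between : ∀ l → pos t < l → l < suc (pos t) + 1 → ¬ Marked l
          between l pos<l l< (hub-l , _)
            with refl ← ≤-antisym (≤-pred (subst (suc l ≤_) (+-comm (suc (pos t)) 1) l<)) pos<l = mid-after t hub-l

        stop : Fin (suc ℓ) → Fin l
        stop t = proj₁ (left-surj (proj₁ (pos-marked t)))

        hub-stop : ∀ t → hub (stop t) ≡ route t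
        hub-stop t = proj₂ (left-surj (proj₁ (pos-marked t)))

        via : Fin (suc ℓ) → Fin r
        via t = proj₁ (right-surj (mid-after t))

        mid-via : ∀ t → mid (via t) ≡ w (suc (pos t))
        mid-via t = proj₂ (right-surj (mid-after t))

      -- A mid has only the edge by which `w` enters it and the one by which `w` leaves. A second
      -- arrival must use the first of these, since after the second the walk is at a hub.
      via-injective : Injective _≡_ _≡_ via
      via-injective {t} {u} eq
        with mid-edge (¬hub⇒2 (mid-after t)) (w-inc (suc (pos t))) (w-inc′ (suc (pos t)))
               (at≢at+1 (suc (pos t))) (subst (Inc (at (suc (pos u)))) (sym same) (w-inc (suc (pos u))))
        where
        same : w (suc (pos t)) ≡ w (suc (pos u))
        same = trans (sym (mid-via t)) (trans (cong mid eq) (mid-via u))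
      ... | inj₁ eq′ = pos-injective (at-suc-injective (sym eq′))
      ... | inj₂ eq′ = ⊥-elim (mid-after u (subst Hub (sym (w-resp eq′)) (hub-after (suc (pos t)) (mid-after t))))

      -- A return to the same hub would need two parallel edges of G between that hub and the mid.
      -- This also rules out a tour with a single stop.
      moved : ∀ t → stop t ≢ stop (next t)
      moved t eq = at≢at+1 (suc (pos t)) (ends-determine (proj₂ (pos-marked t))
        (w-inc′ (pos t)) (w-inc (suc (pos t)))
        (subst (Inc (at (suc (suc (pos t))))) (sym back) (w-inc (suc (suc (pos t))))) (w-inc′ (suc (pos t))))
        where
        back : w (pos t) ≡ w (suc (suc (pos t)))
        back = trans (sym (hub-stop t)) (trans (cong hub eq) (trans (hub-stop (next t)) (route-next t)))

      joined : ∀ t → ends M (via t) ≡ (stop t , stop (next t)) ⊎ ends M (via t) ≡ (stop (next t) , stop t)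
      joined t with adj⇒meets before | adj⇒meets after
        where
        before : Adj G (mid (via t)) (hub (stop t))
        before = subst₂ (Adj G) (sym (mid-via t)) (sym (hub-stop t))
          (inc-adj (proj₂ (pos-marked t) ∘ sym) (w-inc (suc (pos t))) (w-inc′ (pos t)))
        after : Adj G (mid (via t)) (hub (stop (next t)))
        after = subst₂ (Adj G) (sym (mid-via t)) (sym (trans (hub-stop (next t)) (route-next t)))
          (inc-adj (mid-exits (suc (pos t)) (mid-after t)) (w-inc′ (suc (pos t))) (w-inc (suc (suc (pos t)))))
      ... | inj₁ p | inj₂ q = inj₁ (cong₂ _,_ p q)
      ... | inj₂ p | inj₁ q = inj₂ (cong₂ _,_ q p)
      ... | inj₁ p | inj₁ q = ⊥-elim (moved t (trans (sym p) q))
      ... | inj₂ p | inj₂ q = ⊥-elim (moved t (trans (sym p) q))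

      contracted : MHamCycle M
      contracted = record
        { k = ℓ ; c = stop ; d = via ; dinj = via-injective ; joins = joined
        ; inj = λ {t} {u} eq → route-injective (trans (sym (hub-stop t)) (trans (cong hub eq) (hub-stop u)))
        ; surj = stop-surj }
        where
        stop-surj : ∀ a → ∃[ t ] stop t ≡ a
        stop-surj a with route-surj (left a)
        ... | t , eq = t , hub-injective (trans (hub-stop t) eq)

      -- An H-edge between the two edges at `mid b` places the walk at that vertex.
      edge⇒via : ∀ {e f} b → e ≢ f → Inc e (mid b) → Inc f (mid b) → CycEdge H e f → ∃[ t ] via t ≡ b
      edge⇒via b e≢f eb fb ef with edge-w e≢f eb fb ef
      -- One position earlier the walk is at a hub and about to leave it, which is a marked
      -- position.
      ... | j , wj≡ , _ with at-pred (at j)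
      ... | i , eq with pos-covers i (hub-i , λ same → right b (subst Hub (trans same w≡mid) hub-i))
        where
        w≡mid : w (suc i) ≡ mid b
        w≡mid = trans (w-resp eq) wj≡
        hub-i : Hub (w i)
        hub-i with Hub? (w i)
        ... | yes hub-i = hub-i
        ... | no ¬hub-i = ⊥-elim (right b (subst Hub w≡mid (hub-after i ¬hub-i)))
      ... | t , eq′ = t , mid-injective (trans (mid-via t) (trans (w-resp (at-suc eq′)) (trans (w-resp eq) wj≡)))

      -- The edges at a mid are those by which `w` enters and leaves it, so `e` and `f` are these
      -- two consecutive edges of H in some order.
      via⇒edge : ∀ {e f} b → e ≢ f → Inc e (mid b) → Inc f (mid b) → ∃[ t ] via t ≡ b → CycEdge H e f
      via⇒edge _ e≢f eb fb (t , refl)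
        with only (subst (Inc _) (mid-via t) eb) | only (subst (Inc _) (mid-via t) fb)
        where
        only : ∀ {g} → Inc g (w (suc (pos t))) → g ≡ at (suc (pos t)) ⊎ g ≡ at (suc (suc (pos t)))
        only = mid-edge (¬hub⇒2 (mid-after t)) (w-inc (suc (pos t))) (w-inc′ (suc (pos t))) (at≢at+1 (suc (pos t)))
      ... | inj₁ refl | inj₂ refl = at-edge refl refl
      ... | inj₂ refl | inj₁ refl = edge-sym (at-edge refl refl)
      ... | inj₁ refl | inj₁ refl = ⊥-elim (e≢f refl)
      ... | inj₂ refl | inj₂ refl = ⊥-elim (e≢f refl)

    -- Edge `b` of `M` corresponds to the edge of L(G) formed by the two edges at `mid b`, so
    -- exactness is inherited from H and K.
    decomposed : MDecompTwoHam M
    decomposed = C₁.contracted , C₂.contracted , exactly-one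
      where
      module C₁ = Contract H K cover
      module C₂ = Contract K H cover-swap
      exactly-one : ∀ b → ((∃[ t ] C₁.via t ≡ b) ⊎ (∃[ t ] C₂.via t ≡ b)) ×
                          ¬ ((∃[ t ] C₁.via t ≡ b) × (∃[ t ] C₂.via t ≡ b))
      exactly-one b with mid-edges b
      ... | e , f , e≢f , eb , fb =
        Sum.map (C₁.edge⇒via b e≢f eb fb) (C₂.edge⇒via b e≢f eb fb) (cover e f e~f) ,
        λ { (in₁ , in₂) → disjoint e~f (C₁.via⇒edge b e≢f eb fb in₁) (C₂.via⇒edge b e≢f eb fb in₂) }
        where
        e~f : LAdj G e f
        e~f = shared-LAdj e≢f eb fb

theorem1 : ∀ {n : ℕ} (G : SimpleGraph n) →
    (∀ u → ∃[ v ] Adj G u v) →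
    DecompTwoHam (LAdj G) →
    IsoTo G (Fin 6) StarAdj
    ⊎ (Σ[ M ∈ MultiGraph ] (Loopless M × FourRegular M × MDecompTwoHam M
         × IsoTo G (Fin (p M) ⊎ Fin (q M)) (SubAdj M)))
    ⊎ ((∀ u → degree G u ≡ 3) × HamCycle (Adj G))
theorem1 {n} G inhabited (H , K , exactly-one) = by-degree (other-end ev₀)
  where
  open Incidence G
  cover : ∀ x y → LAdj G x y → CycEdge H x y ⊎ CycEdge K x y
  cover x y a = proj₁ (exactly-one x y a)
  disjoint : ∀ {x y} → LAdj G x y → CycEdge H x y → ¬ CycEdge K x y
  disjoint a h k = proj₂ (exactly-one _ _ a) (h , k)
  open DegreeSum H K cover disjoint
  open Decomposition G H K cover disjoint inhabited

  e₀ : Edge G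
  e₀ = c H fz
  v₀ : Fin n
  v₀ = end₁ {G = G} e₀
  ev₀ : Inc e₀ v₀
  ev₀ = src

  subdivided : (∀ v → degree G v ≡ 2 ⊎ degree G v ≡ 4) → ∀ v → degree G v ≡ 4 →
    Σ[ M ∈ MultiGraph ] (Loopless M × FourRegular M × MDecompTwoHam M
         × IsoTo G (Fin (p M) ⊎ Fin (q M)) (SubAdj M))
  subdivided two-or-four v hub-v = M , loopless , four-regular , decomposed , subdivision-iso
    where open Subdivision two-or-four v hub-v

  by-degree : ∃[ u ] (v₀ ≢ u × Inc e₀ u) → _ ⊎ _ ⊎ _
  by-degree (u , v₀≢u , eu) with degree G v₀ in deg-v₀ | degree-sum v₀≢u ev₀ eu | degree-dichotomy ev₀ | degree-pos ev₀ | degree-pos eu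
  ... | 0 | deg-u | _ | () | _
  -- `v₀` is a leaf here, and the other end `u` is the centre.
  ... | 1 | deg-u | _ | _ | _ = inj₁ (star-iso u (suc-injective deg-u))
  ... | 2 | deg-u | others | _ | _ = inj₂ (inj₁ (subdivided
    (λ v → Sum.map₂ (+-cancelʳ-≡ 2 _ 4) (others v)) u (+-cancelˡ-≡ 2 _ 4 deg-u)))
  ... | 3 | deg-u | others | _ | _ = inj₂ (inj₂ (cubic , cubic-hamiltonian cubic v₀))
    where
    cubic : ∀ v → degree G v ≡ 3
    cubic v = [ id , +-cancelʳ-≡ 3 _ 3 ]′ (others v)
  ... | 4 | deg-u | others | _ | _ = inj₂ (inj₁ (subdivided
    (λ v → Sum.swap (Sum.map₂ (+-cancelʳ-≡ 4 _ 2) (others v))) v₀ deg-v₀))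
  ... | 5 | deg-u | _ | _ | _ = inj₁ (star-iso v₀ deg-v₀)
  -- The degree sum 6 would leave `u` with degree 0, although `e₀` ends there.
  ... | suc (suc (suc (suc (suc (suc m))))) | deg-u | _ | _ | 1≤ =
    ⊥-elim (<⇒≢ 1≤ (sym (m+n≡0⇒n≡0 m (+-cancelˡ-≡ 6 _ 0 deg-u))))
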